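{- Let $w\in S_n$, let $m$ be the common length of all climbing chains of $w$, and let $\mathrm{leads}(w)=(L_w(0),\ldots,L_w(d))$, where $d=\mathrm{raj}(w)-\mathrm{inv}(w)$. For $0\le p\le m$ let $\xi_w(p)=(I^p(w),U^p(w))$, where $I^p(w)$ is the $p$th interpolating chain of $w$, $U^0(w)=I^0(w)$, and $$U^p(w)=M(I^p(w))\cup\{I^p(w)_1,I^p(w)_2,\ldots,I^p(w)_{m-p+1}\}\quad\text{for }p\in[m].$$ Then $$\{L_w(0),\ldots,L_w(d)\}=\{\mathrm{wt}(\xi_w(0)),\ldots,\mathrm{wt}(\xi_w(m))\}.$$
   Context: Conventions. Permutations are in one-line notation; $t_{ij}$ is the transposition of $i,j$, and $wt_{ij}$ is $w$ with the values in positions $i$ and $j$ exchanged. $w_0\in S_n$ is the longest permutation, $w_0(k)=n+1-k$. The Bruhat order is the transitive closure of $w\le wt_{ij}$ for $i<j$ with $w(i)<w(j)$; $\lessdot$ denotes its cover relation. $e_1,\dots,e_n$ is the standard basis of $\mathbb{Z}^n$, $|v|=\sum_k v_k$, $[n]=\{1,\ldots,n\}$. Climbing chains. A climbing chain of $w\in S_n$ is a sequence $C=(C_1,\ldots,C_m)$ of pairs (links) $C_p=(i_p,j_p)$ with $i_p<j_p$, $i_1\le\cdots\le i_m$, $wt_{i_1j_1}\cdots t_{i_mj_m}=w_0$, and $wt_{i_1j_1}\cdots t_{i_{p-1}j_{p-1}}\lessdot wt_{i_1j_1}\cdots t_{i_pj_p}$ for each $p\in[m]$. (The only climbing chain of $w_0$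 is empty. The links of a chain are distinct, so $C$ is also regarded as a set. All climbing chains of $w$ have length $m=\ell(w_0)-\ell(w)$, $\ell$ on permutations being the number of inversions.) The set of minimal markings is $M(C)=\{C_p\mid i_{p-1}<i_p,\text{ or } i_{p-1}=i_p\text{ and }j_{p-1}<j_p\}$ with $i_0=0$. A marked climbing chain is a pair $(C,U)$ with $M(C)\subseteq U\subseteq C$. Its weight has $\mathrm{wt}(C,U)_k=n-k-\#\{\text{links of the form }(k,\star)\text{ in }U\}$ for $k\in[n]$. Greedy and nested pairs. Let $w\ne w_0$ and $a=\min\{k\mid w(k)\ne n+1-k\}$. The greedy pair is $\mathrm{greedy}(w)=(a,b)$ with $b=w^{ -1}(w(a)+1)$. An increasing subsequence of $w$ starting from position $q$ is $\alpha=(\alpha_1,\ldots,\alpha_r)$ with $q=\alpha_1<\cdots<\alpha_r\le n$ and $w(\alpha_1)<\cdots<w(\alpha_r)$; $\mathrm{LIS}(w,q)$ is the set of those of maximal length $r$. The nested pair is $\mathrm{nested}(w)=(\alpha_1,\alpha_2)$, where $\alpha$ is the lexicographically last element of $\mathrm{LIS}(w,a)$. Interpolating chains. A link $C_p=(i_p,j_p)$ of a climbing chain $C$ of $w$ is greedy (resp. nested) if it equals the greedy (resp. nested) pair of $wt_{i_1j_1}\cdots t_{i_{p-1}j_{p-1}}$. For $0\le k\le m$, $I^k(w)$ is the unique climbing chain of $w$ whose first $m-k$ links are greedy and whose last $k$ links are nested; $I^k(w)_p$ is its $p$th link. Codes. $\mathrm{invcode}(w)_i=\#\{j>i\mid w(j)<w(i)\}$,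 $\mathrm{inv}(w)=|\mathrm{invcode}(w)|$. $\overline{\mathrm{rajcode}}(w)_i$ is the length of any element of $\mathrm{LIS}(w,i)$ minus one; $\mathrm{rajcode}(w)_k=n-k-\overline{\mathrm{rajcode}}(w)_k$; $\mathrm{raj}(w)=|\mathrm{rajcode}(w)|$. One has $\mathrm{rajcode}(w)_k\ge\mathrm{invcode}(w)_k$ for all $k$. Set $L_w(0)=\mathrm{invcode}(w)$; for $1\le i\le d$ let $j\in[n]$ be the largest index with $L_w(i-1)_j<\mathrm{rajcode}(w)_j$ and set $L_w(i)=L_w(i-1)+e_j$. -}

module Defs where

open import Data.Bool.Base using (Bool; true; if_then_else_)
open import Data.Fin.Base using (Fin; toℕ; _≤_; _<_)
open import Data.Fin.Permutation
  using (Permutation′; _⟨$⟩ʳ_; _≈_; _∘ₚ_; transpose; reverse)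
open import Data.Fin.Properties using (_≟_; _<?_)
import Data.Fin.Properties as Fin
open import Data.Fin.Subset using (Subset; ⊤; _∪_)
open import Data.Fin.Subset.Properties using (_∈?_)
open import Data.Integer.Base as ℤ using (ℤ; +_)
import Data.Integer.Properties as ℤ
open import Data.List.Base
  using (List; []; _∷_; [_]; _++_; map; length; filter; foldl; take; lookup; last; head; allFin)
open import Data.List.Extrema.Nat using (max; max≤v⁺; xs≤max)
open import Data.List.Membership.Propositional using (_∈_)
open import Data.List.Membership.Propositional.Properties
  using (∈-map⁺; ∈-++⁺ˡ; ∈-++⁺ʳ; ∈-filter⁺; ∈-allFin)
open import Data.List.Relation.Binary.Lex.Strict using (Lex-≤)
open import Data.List.Relation.Unary.All as All using (All; []; _∷_)
open import Data.List.Relation.Unary.All.Properties using (all-filter) renaming (map⁺ to All-map⁺)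
open import Data.List.Relation.Unary.AllPairs using (AllPairs; []; _∷_)
open import Data.List.Relation.Unary.AllPairs.Properties using (tabulate⁺-<)
open import Data.List.Relation.Unary.Any using (here; there)
open import Data.List.Relation.Unary.Linked as Linked using (Linked; linked?)
open import Data.List.Relation.Unary.Linked.Properties using (Linked⇒AllPairs)
open import Data.Maybe.Base using (just; maybe′)
open import Data.Maybe.Properties using (≡-dec)
open import Data.Nat.Base as ℕ using (ℕ; zero; suc; pred; _∸_)
import Data.Nat.Properties as ℕ
open import Data.Product.Base using (∃-syntax; _×_; _,_; proj₁; proj₂)
import Data.Vec.Base as Vec
open import Relation.Binary.Construct.Closure.Transitive using (TransClosure)
open import Function.Base using (case_of_)
open import Relation.Binary.PropositionalEquality using (_≡_; _≢_; refl; cong)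
open import Relation.Nullary using (¬_; does; contradiction)
open import Relation.Nullary.Decidable using (_×-dec_; _⊎-dec_)
open import Relation.Unary using (Pred; Decidable)
open import Algebra.Properties.CommutativeMonoid.Sum ℤ.+-0-commutativeMonoid using (sum)
open import Level using (0ℓ)

private
  variable
    n : ℕ

-- Positions and values are elements of Fin n, so k ∈ [n] is the element whose
-- toℕ is k - 1.  Permutations are functions, compared up to pointwise equality _≈_.

Link : ℕ → Set
Link n = Fin n × Fin n

#[_] : {P : Pred (Fin n) 0ℓ} → Decidable P → ℕ
#[ P? ] = length (filter P? (allFin _))

------------------------------------------------------------------------
-- Permutations and Bruhat order

w₀ : Permutation′ n
w₀ = reverse

-- π ∘ₚ ρ applies π first, so (w · (i , j)) k = w (t_ij k): the values in
-- positions i and j are exchanged.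
_·_ : Permutation′ n → Link n → Permutation′ n
w · (i , j) = transpose i j ∘ₚ w

_··_ : Permutation′ n → List (Link n) → Permutation′ n
_··_ = foldl _·_

_→ᴮ_ : Permutation′ n → Permutation′ n → Set
u →ᴮ v = ∃[ i ] ∃[ j ] i < j × u ⟨$⟩ʳ i < u ⟨$⟩ʳ j × v ≈ u · (i , j)

-- Each step adds inversions, so this is the strict part of the Bruhat order.
_<ᴮ_ : Permutation′ n → Permutation′ n → Set
_<ᴮ_ = TransClosure _→ᴮ_

_⋖_ : Permutation′ n → Permutation′ n → Set
u ⋖ v = u <ᴮ v × (∀ x → ¬ (u <ᴮ x × x <ᴮ v))

------------------------------------------------------------------------
-- Climbing chains

-- The index p : Fin (length C) stands for the link numbered toℕ p + 1, so
-- w ·· take (toℕ p) C is the permutation to which that link is applied.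
record IsClimbingChain (w : Permutation′ n) (C : List (Link n)) : Set where
  field
    ordered  : All (λ (i , j) → i < j) C
    climbing : Linked (λ (i , _) (i′ , _) → i ≤ i′) C
    reaches  : (w ·· C) ≈ w₀
    covers   : ∀ (p : Fin (length C)) →
               (w ·· take (toℕ p) C) ⋖ (w ·· take (suc (toℕ p)) C)

-- Since the links of a climbing chain are distinct, a set of its links is
-- represented by the set of their indices, a Subset (length C).

ascends : Link n → Link n → Bool
ascends (i , j) (i′ , j′) = does ((i <? i′) ⊎-dec ((i ≟ i′) ×-dec (j <? j′)))

minimalAfter : Link n → (C : List (Link n)) → Subset (length C)
minimalAfter c []       = Vec.[]
minimalAfter c (c′ ∷ C) = ascends c c′ Vec.∷ minimalAfter c′ C

-- The first link is always in M C, by the convention i₀ = 0.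
M : (C : List (Link n)) → Subset (length C)
M []      = Vec.[]
M (c ∷ C) = true Vec.∷ minimalAfter c C

firstLinks : ℕ → (C : List (Link n)) → Subset (length C)
firstLinks r C = Vec.tabulate (λ p → does (toℕ p ℕ.<? r))

-- n - k - #{links (k , ⋆) in U} for k one-based.
wt : (C : List (Link n)) → Subset (length C) → Fin n → ℤ
wt {n} C U k =
  + n ℤ.- + suc (toℕ k)
      ℤ.- + #[ (λ p → (p ∈? U) ×-dec (proj₁ (lookup C p) ≟ k)) ]

------------------------------------------------------------------------
-- Longest increasing subsequences

IncreasingFrom : Permutation′ n → Fin n → List (Fin n) → Set
IncreasingFrom w q α =
  head α ≡ just q × Linked (λ i j → i < j × w ⟨$⟩ʳ i < w ⟨$⟩ʳ j) α

LIS : Permutation′ n → Fin n → List (Fin n) → Set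
LIS w q α =
  IncreasingFrom w q α × (∀ β → IncreasingFrom w q β → length β ℕ.≤ length α)

LexLastLIS : Permutation′ n → Fin n → List (Fin n) → Set
LexLastLIS w q α = LIS w q α × (∀ β → LIS w q β → Lex-≤ _≡_ _<_ β α)

increasingFrom? : (w : Permutation′ n) (q : Fin n) → Decidable (IncreasingFrom w q)
increasingFrom? w q α =
  ≡-dec _≟_ (head α) (just q)
    ×-dec linked? (λ i j → (i <? j) ×-dec ((w ⟨$⟩ʳ i) <? (w ⟨$⟩ʳ j))) α

subsequences : ∀ {A : Set} → List A → List (List A)
subsequences []       = [ [] ]
subsequences (x ∷ xs) = map (x ∷_) (subsequences xs) ++ subsequences xs

-- Every list satisfying IncreasingFrom w q is a subsequence of allFin n, so the
-- maximum is the length of any element of LIS w q; see LIS-length below.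
rajcode‾ : Permutation′ n → Fin n → ℕ
rajcode‾ {n} w q =
  pred (max 0 (map length (filter (increasingFrom? w q) (subsequences (allFin n)))))

sorted⇒∈subsequences : ∀ {xs α : List (Fin n)} → AllPairs _<_ xs → AllPairs _<_ α →
                       All (_∈ xs) α → α ∈ subsequences xs
sorted⇒∈subsequences [] _ [] = here refl
sorted⇒∈subsequences [] _ (() ∷ _)
sorted⇒∈subsequences {xs = x ∷ xs} (x< ∷ xs↗) [] [] =
  ∈-++⁺ʳ (map (x ∷_) (subsequences xs)) (sorted⇒∈subsequences xs↗ [] [])
sorted⇒∈subsequences {n} {x ∷ xs} (x< ∷ xs↗) (a< ∷ α↗) (a∈ ∷ α∈) =
  case a∈ of λ where
    (here refl) → ∈-++⁺ˡ (∈-map⁺ (x ∷_) (sorted⇒∈subsequences xs↗ α↗ (above a< α∈)))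
    (there a∈′) → ∈-++⁺ʳ (map (x ∷_) (subsequences xs))
      (sorted⇒∈subsequences xs↗ (a< ∷ α↗)
        (a∈′ ∷ above (All.map (Fin.<-trans (All.lookup x< a∈′)) a<) α∈))
  where
  above : ∀ {γ : List (Fin n)} → All (x <_) γ → All (_∈ x ∷ xs) γ → All (_∈ xs) γ
  above []          []              = []
  above (x<x ∷ _)   (here refl ∷ _) = contradiction x<x (Fin.<-irrefl refl)
  above (_   ∷ x<γ) (there c∈ ∷ γ∈) = c∈ ∷ above x<γ γ∈

LIS-length : ∀ (w : Permutation′ n) {q α} → LIS w q α → rajcode‾ w q ≡ length α ∸ 1
LIS-length {n} w {q} {α} (α-inc , longest) = cong pred (ℕ.≤-antisym upper lower)
  where
  found : List (List (Fin n))
  found = filter (increasingFrom? w q) (subsequences (allFin n))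

  α↗ : AllPairs _<_ α
  α↗ = Linked⇒AllPairs Fin.<-trans (Linked.map proj₁ (proj₂ α-inc))

  α∈found : α ∈ found
  α∈found = ∈-filter⁺ (increasingFrom? w q)
    (sorted⇒∈subsequences (tabulate⁺-< (λ i<j → i<j)) α↗ (All.universal ∈-allFin α)) α-inc

  upper : max 0 (map length found) ℕ.≤ length α
  upper = max≤v⁺ {xs = map length found} ℕ.z≤n (All-map⁺ (All.map (λ {β} → longest β)
    (all-filter (increasingFrom? w q) (subsequences (allFin n)))))

  lower : length α ℕ.≤ max 0 (map length found)
  lower = All.lookup (xs≤max 0 (map length found)) (∈-map⁺ length α∈found)

------------------------------------------------------------------------
-- Codes and leads

invcode : Permutation′ n → Fin n → ℤ
invcode w i = + #[ (λ j → (i <? j) ×-dec ((w ⟨$⟩ʳ j) <? (w ⟨$⟩ʳ i))) ]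

inv : Permutation′ n → ℤ
inv w = sum (invcode w)

rajcode : Permutation′ n → Fin n → ℤ
rajcode {n} w k = + n ℤ.- + suc (toℕ k) ℤ.- + rajcode‾ w k

raj : Permutation′ n → ℤ
raj w = sum (rajcode w)

e : Fin n → Fin n → ℤ
e j k = if does (j ≟ k) then + 1 else + 0

-- allFin is increasing, so last picks the largest index.  There is such an index
-- as long as i < raj w - inv w; beyond that range L w is constant.
L : Permutation′ n → ℕ → Fin n → ℤ
L w zero    = invcode w
L w (suc i) =
  maybe′ (λ j k → L w i k ℤ.+ e j k) (L w i)
         (last (filter (λ j → L w i j ℤ.<? rajcode w j) (allFin _)))

------------------------------------------------------------------------
-- Greedy and nested pairs, interpolating chains

-- a = min { k | w(k) ≠ n + 1 - k }; there is no such a when w is w₀.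
FirstUnsorted : Permutation′ n → Fin n → Set
FirstUnsorted w a =
  w ⟨$⟩ʳ a ≢ w₀ ⟨$⟩ʳ a × (∀ k → k < a → w ⟨$⟩ʳ k ≡ w₀ ⟨$⟩ʳ k)

IsGreedyPair : Permutation′ n → Link n → Set
IsGreedyPair w (a , b) =
  FirstUnsorted w a × toℕ (w ⟨$⟩ʳ b) ≡ suc (toℕ (w ⟨$⟩ʳ a))

IsNestedPair : Permutation′ n → Link n → Set
IsNestedPair w (a , b) =
  FirstUnsorted w a × ∃[ γ ] LexLastLIS w a (a ∷ b ∷ γ)

-- C is Iᵏ(w).
record IsInterpolatingChain (w : Permutation′ n) (k : ℕ) (C : List (Link n)) : Set where
  field
    isClimbingChain : IsClimbingChain w C
    k≤length        : k ℕ.≤ length C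
    greedy : ∀ (p : Fin (length C)) → toℕ p ℕ.< length C ∸ k →
             IsGreedyPair (w ·· take (toℕ p) C) (lookup C p)
    nested : ∀ (p : Fin (length C)) → length C ∸ k ℕ.≤ toℕ p →
             IsNestedPair (w ·· take (toℕ p) C) (lookup C p)

-- The marking Uᵖ(w), as a function of the chain C = Iᵖ(w).
U : ℕ → (C : List (Link n)) → Subset (length C)
U zero      C = ⊤
U p@(suc _) C = M C ∪ firstLinks (length C ∸ p ℕ.+ 1) C

{-# OPTIONS --safe #-}
-- Let invcode‾ w k be the number of j > k with w j > w k, and let x k count the marked
-- links (k , ⋆), so that a weight is n - k - x k.  An exchange at a greedy pair (a , b)
-- leaves rajcode‾ and invcode‾ unchanged away from a; at a it lowers invcode‾ by one
-- and rajcode‾ by zero or one.  An exchange at a nested pair leaves rajcode‾ unchanged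
-- away from a; at a it lowers rajcode‾ by one exactly when the following nested link
-- is ascending (or no longer at a), so the minimal markings of a nested chain count
-- rajcode‾.  Hence the weights of the interpolating chains and the leads are both
-- described by the vectors x with rajcode‾ ≤ x ≤ invcode‾ such that x j = invcode‾ j or
-- x k = rajcode‾ k whenever j < k.
module Submission where

open import Defs
open import Data.Fin.Permutation using (Permutation′)
open import Data.Integer.Base as ℤ using (ℤ; +_)
open import Data.List.Base using (length)
open import Data.Nat.Base as ℕ using (ℕ)
open import Data.Product.Base using (_×_; ∃-syntax)
open import Relation.Binary.PropositionalEquality using (_≡_; _≗_)
open import Relation.Unary using (_≐_)
open import Data.Bool.Base using (true; false; if_then_else_)
open import Data.Bool.Properties using (∨-zeroʳ; if-eta)
open import Data.Fin.Base using (Fin; zero; suc; toℕ; fromℕ<; inject; opposite; _≤_; _<_)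
open import Data.Fin.Permutation using (_⟨$⟩ʳ_; _⟨$⟩ˡ_; _≈_; inverseʳ; inverseˡ)
import Data.Fin.Properties as Fin
open import Data.Fin.Properties using (_≟_; _<?_; _≤?_)
open import Data.Fin.Subset using (Subset; ⊥; _∪_)
open import Data.Fin.Subset.Properties using (_∈?_; ∪-identityʳ)
import Data.Integer.Properties as ℤ
import Data.Integer.Solver as ℤ
open import Data.List.Base
  using (List; []; _∷_; filter; tabulate; allFin; take; lookup; last)
import Data.List.Extrema as Extrema
open import Data.List.Extrema.Nat using (argmax; argmax-all; f[xs]≤f[argmax])
open import Data.List.Membership.Propositional using (_∈_)
open import Data.List.Membership.Propositional.Properties using (∈-filter⁺; ∈-filter⁻; ∈-allFin)
import Data.List.Relation.Binary.Lex.Strict as Lex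
open Lex using (Lex-≤; this; next)
open import Data.List.Relation.Unary.All as All using (All; []; _∷_)
open import Data.List.Relation.Unary.All.Properties using (all-filter)
open import Data.List.Relation.Unary.AllPairs as AllPairs using (AllPairs; []; _∷_)
open import Data.List.Relation.Unary.AllPairs.Properties using (tabulate⁺-<)
open import Data.List.Relation.Unary.Any using (here; there)
open import Data.List.Relation.Unary.Linked as Linked using (Linked; []; [-]; _∷_)
open import Data.List.Relation.Unary.Linked.Properties using (Linked⇒AllPairs)
open import Data.Maybe.Base using (Maybe; just; nothing; fromMaybe; maybe′)
open import Data.Nat.Base using (zero; suc; pred; _+_; _*_; _∸_; z≤n; s≤s)
open import Data.Nat.Induction using (<-wellFounded)
import Data.Nat.Properties as ℕ
open import Data.Nat.Solver using (module +-*-Solver)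
open import Data.Product.Base using (_,_; proj₁; proj₂)
open import Data.Sum.Base using (_⊎_; inj₁; inj₂; [_,_]′)
open import Data.Vec.Base using (_∷_)
open import Data.Vec.Functional using (updateAt)
open import Data.Vec.Functional.Properties using (updateAt-updates; updateAt-minimal)
open import Function.Base using (_∘_; const; case_of_; id)
open import Function.Bundles using (mk⇔)
import Induction.WellFounded as WF
open import Level using (0ℓ)
open import Relation.Binary.Bundles using (DecTotalOrder)
open import Relation.Binary.Construct.Closure.Transitive using ([_]; _∷_; _++_)
import Relation.Binary.Construct.On as On
open import Relation.Binary.Definitions using (tri<; tri≈; tri>)
open import Relation.Binary.PropositionalEquality
  using (_≢_; refl; sym; trans; cong; cong₂; subst; subst₂; module ≡-Reasoning)
open import Relation.Nullary using (¬_; Dec; yes; no; does; contradiction)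
open import Relation.Nullary.Decidable using (_×-dec_; _⊎-dec_; dec-true; dec-false; does-⇔)
open import Relation.Unary using (Pred; Decidable)
open import Algebra.Properties.CommutativeMonoid.Sum ℤ.+-0-commutativeMonoid
  using () renaming (sum to Σℤ)
open import Algebra.Properties.CommutativeMonoid.Sum ℕ.+-0-commutativeMonoid
  using (sum-cong-≗; sum-replicate-zero; ∑-distrib-+) renaming (sum to Σ)

-- Leads and interpolating chains are not matched index by index, because their numbers differ:
-- there are `raj w - inv w + 1` leads but `m + 1` chains. Making one more link greedy adds one mark
-- at its first position `a` and replaces `rajcode‾` in the remaining count by its value after the
-- exchange. The weight therefore repeats if `rajcode‾` drops at `a`, and otherwise decreases by one
-- there. Both families are instead compared as sets, through a description without index. The order
-- condition in that description says that `x` agrees with `invcode‾` before some position and with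
-- `rajcode‾` after it. The two constructions produce this shape from opposite ends: greedy links
-- work through the positions from the left, while leads lower the entries of `invcode‾` starting
-- from the right. A separate obstacle is that a cover excludes every intermediate permutation of a
-- transitive closure. This is what requires a strictly monotone statistic and rank functions for
-- the Bruhat order.

private
  variable
    n p : ℕ
    P Q : Set
    w : Permutation′ n
    c : Link n
    C : List (Link n)

-- Sums and counts

ind : Dec P → ℕ
ind P? = if does P? then 1 else 0

ind-yes : (P? : Dec P) → P → ind P? ≡ 1
ind-yes P? p rewrite dec-true P? p = refl

ind-no : (P? : Dec P) → ¬ P → ind P? ≡ 0
ind-no P? ¬p rewrite dec-false P? ¬p = refl

ind-cong : (P? : Dec P) (Q? : Dec Q) → (P → Q) → (Q → P) → ind P? ≡ ind Q?
ind-cong P? Q? f g = cong (if_then 1 else 0) (does-⇔ (mk⇔ f g) P? Q?)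

ind-mono : (P? : Dec P) (Q? : Dec Q) → (P → Q) → ind P? ℕ.≤ ind Q?
ind-mono (no _)  _  f = z≤n
ind-mono (yes p) Q? f = ℕ.≤-reflexive (sym (ind-yes Q? (f p)))

count≡Σ : {P : Pred (Fin n) 0ℓ} (P? : Decidable P) → #[ P? ] ≡ Σ (λ i → ind (P? i))
count≡Σ P? = go id P?
  where
  go : ∀ {k} {A : Set} {P : Pred A 0ℓ} (f : Fin k → A) (P? : Decidable P) →
       length (filter P? (tabulate f)) ≡ Σ (λ i → ind (P? (f i)))
  go {zero}  f P? = refl
  go {suc k} f P? with P? (f zero)
  ... | yes _ = cong suc (go (f ∘ suc) P?)
  ... | no _  = go (f ∘ suc) P?

-- Each sum is completed by the summand that only the other one has; this additive form avoids
-- truncated subtraction.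
Σ-update : ∀ {f g : Fin n → ℕ} k → (∀ m → m ≢ k → f m ≡ g m) → Σ g + f k ≡ Σ f + g k
Σ-update {suc n} {f} {g} zero f≗g = begin
  g zero + Σ (g ∘ suc) + f zero   ≡⟨ solve 3 (λ x y z → x :+ y :+ z := z :+ y :+ x) refl
                                       (g zero) _ (f zero) ⟩
  f zero + Σ (g ∘ suc) + g zero   ≡⟨ cong (λ s → f zero + s + g zero)
                                       (sum-cong-≗ λ m → f≗g (suc m) λ ()) ⟨
  f zero + Σ (f ∘ suc) + g zero   ∎
  where open ≡-Reasoning
        open +-*-Solver
Σ-update {suc n} {f} {g} (suc k) f≗g = begin
  g zero + Σ (g ∘ suc) + f (suc k)    ≡⟨ ℕ.+-assoc (g zero) _ _ ⟩
  g zero + (Σ (g ∘ suc) + f (suc k))  ≡⟨ cong₂ _+_ (sym (f≗g zero λ ()))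
    (Σ-update k λ m m≢k → f≗g (suc m) (m≢k ∘ Fin.suc-injective)) ⟩
  f zero + (Σ (f ∘ suc) + g (suc k))  ≡⟨ ℕ.+-assoc (f zero) _ _ ⟨
  f zero + Σ (f ∘ suc) + g (suc k)    ∎
  where open ≡-Reasoning

Σ-update₂ : ∀ {f g : Fin n → ℕ} {k l} → k ≢ l → (∀ m → m ≢ k → m ≢ l → f m ≡ g m) →
            Σ g + (f k + f l) ≡ Σ f + (g k + g l)
Σ-update₂ {f = f} {g} {k} {l} k≢l f≗g = begin
  Σ g + (f k + f l)  ≡⟨ solve 3 (λ x y z → x :+ (y :+ z) := x :+ z :+ y) refl (Σ g) (f k) (f l) ⟩
  Σ g + f l + f k    ≡⟨ cong (λ z → Σ g + z + f k) (h≗f l (k≢l ∘ sym)) ⟨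
  Σ g + h l + f k    ≡⟨ cong (_+ f k) (Σ-update l h≗g) ⟩
  Σ h + g l + f k    ≡⟨ solve 3 (λ x y z → x :+ y :+ z := x :+ z :+ y) refl (Σ h) (g l) (f k) ⟩
  Σ h + f k + g l    ≡⟨ cong (_+ g l) (Σ-update k λ m m≢k → sym (h≗f m m≢k)) ⟩
  Σ f + h k + g l    ≡⟨ cong (λ z → Σ f + z + g l) hk ⟩
  Σ f + g k + g l    ≡⟨ ℕ.+-assoc (Σ f) _ _ ⟩
  Σ f + (g k + g l)  ∎
  where
  open ≡-Reasoning
  open +-*-Solver
  h : Fin _ → ℕ
  h = updateAt f k (const (g k))
  hk : h k ≡ g k
  hk = updateAt-updates k f
  h≗f : ∀ m → m ≢ k → h m ≡ f m
  h≗f m m≢k = updateAt-minimal m k f m≢k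
  h≗g : ∀ m → m ≢ l → h m ≡ g m
  h≗g m m≢l with m ≟ k
  ... | yes refl = hk
  ... | no m≢k   = trans (h≗f m m≢k) (f≗g m m≢k m≢l)

fk≤Σf : ∀ (f : Fin n → ℕ) k → f k ℕ.≤ Σ f
fk≤Σf f zero    = ℕ.m≤m+n _ _
fk≤Σf f (suc k) = ℕ.≤-trans (fk≤Σf (f ∘ suc) k) (ℕ.m≤n+m _ _)

least : {P : Pred (Fin n) 0ℓ} → Decidable P → ¬ (∀ i → P i) → ∃[ i ] ¬ P i × (∀ j → j < i → P j)
least {P = P} P? ¬∀P with Fin.¬∀⟶∃¬-smallest _ _ P? ¬∀P
... | i , ¬Pi , below = i , ¬Pi , λ j j<i → subst P (inject-fromℕ< j<i) (below (fromℕ< j<i))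
  where
  inject-fromℕ< : ∀ {i j : Fin _} (j<i : j < i) → inject {i = i} (fromℕ< j<i) ≡ j
  inject-fromℕ< j<i = Fin.toℕ-injective (trans (Fin.toℕ-inject (fromℕ< j<i)) (Fin.toℕ-fromℕ< j<i))

-- Exchanging two values

module _ (w : Permutation′ n) where

  ·-left : ∀ i j → (w · (i , j)) ⟨$⟩ʳ i ≡ w ⟨$⟩ʳ j
  ·-left i j rewrite dec-true (i ≟ i) refl = refl

  ·-right : ∀ i j → (w · (i , j)) ⟨$⟩ʳ j ≡ w ⟨$⟩ʳ i
  ·-right i j with j ≟ i
  ... | yes refl = refl
  ... | no _ rewrite dec-true (j ≟ j) refl = refl

  ·-other : ∀ {i j k} → k ≢ i → k ≢ j → (w · (i , j)) ⟨$⟩ʳ k ≡ w ⟨$⟩ʳ k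
  ·-other {i} {j} {k} k≢i k≢j rewrite dec-false (k ≟ i) k≢i | dec-false (k ≟ j) k≢j = refl

  injective : ∀ {i j} → w ⟨$⟩ʳ i ≡ w ⟨$⟩ʳ j → i ≡ j
  injective eq = trans (sym (inverseˡ w)) (trans (cong (w ⟨$⟩ˡ_) eq) (inverseˡ w))

-- Covers in the Bruhat order

-- Takes the place of the inversion number: a Bruhat step at `(i , j)` lowers it by the product of
-- `j - i` and the difference of the two values, and only two summands change. It serves both for
-- irreflexivity of the order and as the induction measure for chains.
μ : Permutation′ n → ℕ
μ w = Σ (λ k → toℕ k * toℕ (w ⟨$⟩ʳ k))

rearrangement : ∀ {i j a b} → i ℕ.< j → a ℕ.< b → i * b + j * a ℕ.< i * a + j * b
rearrangement {i} {j} {a} {b} i<j a<b with ℕ.m≤n⇒∃[o]m+o≡n i<j | ℕ.m≤n⇒∃[o]m+o≡n a<b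
-- The two sides differ by `(1 + c) * (1 + d)`; one unit pays for strictness and `c + d + c * d` is
-- left over.
... | c , refl | d , refl = ℕ.≤-trans (s≤s (ℕ.m≤m+n _ (c + d + c * d))) (ℕ.≤-reflexive
  (solve 4 (λ i a c d →
    con 1 :+ (i :* (con 1 :+ a :+ d) :+ (con 1 :+ i :+ c) :* a :+ (c :+ d :+ c :* d))
      := i :* a :+ (con 1 :+ i :+ c) :* (con 1 :+ a :+ d)) refl i a c d))
  where open +-*-Solver

+-exchange-< : ∀ {x y a b} → x + a ≡ y + b → b ℕ.< a → x ℕ.< y
+-exchange-< {x} {y} {a} {b} eq b<a = ℕ.≰⇒> λ y≤x →
  ℕ.<-irrefl (sym eq) (ℕ.+-mono-≤-< y≤x b<a)

+-exchange-≤ : ∀ {x y a b} → x + a ≡ y + b → b ℕ.≤ a → x ℕ.≤ y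
+-exchange-≤ {x} {y} {a} {b} eq b≤a = ℕ.≮⇒≥ λ y<x →
  ℕ.<-irrefl (sym eq) (ℕ.+-mono-<-≤ y<x b≤a)

-- The rank function from the standard criterion for Bruhat order. The proof uses the direction that
-- the order implies pointwise inequality.
rank : Permutation′ n → Fin n → Fin n → ℕ
rank w p q = Σ (λ m → ind ((m ≤? p) ×-dec (q <? (w ⟨$⟩ʳ m))))

module Step (u v : Permutation′ n) {i j : Fin n} (i<j : i < j) (ui<uj : u ⟨$⟩ʳ i < u ⟨$⟩ʳ j)
            (v≈ : v ≈ (u · (i , j))) where

  private
    ui uj : Fin n
    ui = u ⟨$⟩ʳ i
    uj = u ⟨$⟩ʳ j

    i≢j : i ≢ j
    i≢j refl = Fin.<-irrefl refl i<j

    vi : v ⟨$⟩ʳ i ≡ u ⟨$⟩ʳ j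
    vi = trans (v≈ i) (·-left u i j)

    vj : v ⟨$⟩ʳ j ≡ u ⟨$⟩ʳ i
    vj = trans (v≈ j) (·-right u i j)

    vm : ∀ m → m ≢ i → m ≢ j → u ⟨$⟩ʳ m ≡ v ⟨$⟩ʳ m
    vm m m≢i m≢j = sym (trans (v≈ m) (·-other u m≢i m≢j))

  μ-decreases : μ v ℕ.< μ u
  μ-decreases = +-exchange-< (Σ-update₂ i≢j λ m m≢i m≢j → cong (λ x → toℕ m * toℕ x) (vm m m≢i m≢j))
    (subst₂ (λ x y → toℕ i * toℕ x + toℕ j * toℕ y ℕ.<
                     toℕ i * toℕ (u ⟨$⟩ʳ i) + toℕ j * toℕ (u ⟨$⟩ʳ j))
            (sym vi) (sym vj) (rearrangement i<j ui<uj))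

  module _ (p q : Fin n) where

    private
      at : Fin n → Fin n → ℕ
      at m x = ind ((m ≤? p) ×-dec (q <? x))

      change : rank v p q + (at i ui + at j uj) ≡
               rank u p q + (at i uj + at j ui)
      change = subst₂ (λ x y → rank v p q + (at i ui + at j uj) ≡
                               rank u p q + (at i x + at j y)) vi vj
        (Σ-update₂ i≢j λ m m≢i m≢j → cong (at m) (vm m m≢i m≢j))

      beyond : ∀ m x → p < m → at m x ≡ 0
      beyond m x p<m = ind-no ((m ≤? p) ×-dec (q <? x)) (λ (m≤p , _) → ℕ.<⇒≱ p<m m≤p)

      below : ∀ m x → x ≤ q → at m x ≡ 0
      below m x x≤q = ind-no ((m ≤? p) ×-dec (q <? x)) (λ (_ , q<x) → ℕ.<⇒≱ q<x x≤q)

      inside : ∀ m x → m ≤ p → q < x → at m x ≡ 1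
      inside m x m≤p q<x = ind-yes ((m ≤? p) ×-dec (q <? x)) (m≤p , q<x)

      unchanged : at i ui + at j uj ≡ at i uj + at j ui →
                  rank v p q ≡ rank u p q
      unchanged eq = ℕ.+-cancelʳ-≡ _ _ _ (trans change (cong (rank u p q ℕ.+_) (sym eq)))

      at-left : at i ui ℕ.≤ at i uj
      at-left = ind-mono ((i ≤? p) ×-dec (q <? ui)) ((i ≤? p) ×-dec (q <? uj))
        λ (i≤p , q<ui) → i≤p , Fin.<-trans q<ui ui<uj

      at-both : j ≤ p → at i ui + at j uj ≡ at i uj + at j ui
      at-both j≤p = trans (ℕ.+-comm (at i ui) (at j uj)) 
        (cong₂ _+_ (swap uj j≤p i≤p) (swap ui i≤p j≤p))
        where
        i≤p : i ≤ p
        i≤p = ℕ.≤-trans (ℕ.<⇒≤ i<j) j≤p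
        swap : ∀ {k l} x → k ≤ p → l ≤ p → at k x ≡ at l x
        swap {k} {l} x k≤p l≤p = ind-cong ((k ≤? p) ×-dec (q <? x)) ((l ≤? p) ×-dec (q <? x))
          (λ (_ , q<x) → l≤p , q<x) (λ (_ , q<x) → k≤p , q<x)

    rank-mono : rank u p q ℕ.≤ rank v p q
    rank-mono with j ≤? p
    ... | yes j≤p = ℕ.≤-reflexive (sym (unchanged (at-both j≤p)))
    ... | no j≰p  = +-exchange-≤ (sym change)
      (ℕ.+-mono-≤ at-left (ℕ.≤-reflexive
        (trans (beyond j uj (ℕ.≰⇒> j≰p)) (sym (beyond j ui (ℕ.≰⇒> j≰p))))))

    -- Of the four terms in `change`, only the new one at `i` survives in this region. Together with
    -- `rank-outside` this confines the rectangle of one step to that of a larger interval.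
    rank-inside : i ≤ p → p < j → ui ≤ q → q < uj → rank u p q ℕ.< rank v p q
    rank-inside i≤p p<j ui≤q q<uj = +-exchange-< (sym change) (subst₂ ℕ._<_
      (sym (cong₂ _+_ (below i ui ui≤q) (beyond j uj p<j)))
      (sym (cong₂ _+_ (inside i uj i≤p q<uj) (beyond j ui p<j))) (s≤s z≤n))

    rank-outside : rank u p q ℕ.< rank v p q → (i ≤ p × p < j) × ui ≤ q × q < uj
    rank-outside u<v = (i≤p , p<j) , ui≤q , q<uj
      where
      impossible : ∀ {A : Set} →
        at i ui + at j uj ≡ at i uj + at j ui → A
      impossible eq = contradiction u<v (ℕ.<-irrefl (sym (unchanged eq)))
      p<j : p < j
      p<j = ℕ.≰⇒> λ j≤p → impossible (at-both j≤p)
      cancel : at i ui ≡ at i uj → ∀ {A : Set} → A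
      cancel eq = impossible (cong₂ _+_ eq (trans (beyond j uj p<j) (sym (beyond j ui p<j))))
      i≤p : i ≤ p
      i≤p = ℕ.≮⇒≥ λ p<i → cancel (trans (beyond i ui p<i) (sym (beyond i uj p<i)))
      ui≤q : ui ≤ q
      ui≤q = ℕ.≮⇒≥ λ q<ui → cancel (ind-cong ((i ≤? p) ×-dec (q <? ui)) ((i ≤? p) ×-dec (q <? uj))
        (λ (i≤p , _) → i≤p , Fin.<-trans q<ui ui<uj) (λ (i≤p , _) → i≤p , q<ui))
      q<uj : q < uj
      q<uj = ℕ.≰⇒> λ uj≤q → cancel
        (trans (below i ui (ℕ.≤-trans (ℕ.<⇒≤ ui<uj) uj≤q)) (sym (below i uj uj≤q)))

μ-decreases⁺ : {u v : Permutation′ n} → u <ᴮ v → μ v ℕ.< μ u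
μ-decreases⁺ {u = u} {v} [ _ , _ , i<j , ui<uj , v≈ ] = Step.μ-decreases u v i<j ui<uj v≈
μ-decreases⁺ {u = u} (_∷_ {y = x} (_ , _ , i<j , ui<uj , x≈) x<v) =
  ℕ.<-trans (μ-decreases⁺ x<v) (Step.μ-decreases u x i<j ui<uj x≈)

rank-mono⁺ : {u v : Permutation′ n} → u <ᴮ v → ∀ p q → rank u p q ℕ.≤ rank v p q
rank-mono⁺ {u = u} {v} [ _ , _ , i<j , ui<uj , v≈ ] = Step.rank-mono u v i<j ui<uj v≈
rank-mono⁺ {u = u} (_∷_ {y = x} (_ , _ , i<j , ui<uj , x≈) x<v) p q =
  ℕ.≤-trans (Step.rank-mono u x i<j ui<uj x≈ p q) (rank-mono⁺ x<v p q)

-- The criterion for a cover in terms of the permutation graph. Greedy pairs satisfy it because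
-- their values are adjacent, nested pairs because a point in between would lengthen the
-- subsequence, so the two kinds of link share everything stated for it.
record Tight (w : Permutation′ n) (a b : Fin n) : Set where
  constructor tight
  field
    a<b     : a < b
    wa<wb   : w ⟨$⟩ʳ a < w ⟨$⟩ʳ b
    between : ∀ m → a < m → m < b → w ⟨$⟩ʳ a < w ⟨$⟩ʳ m → ¬ w ⟨$⟩ʳ m < w ⟨$⟩ʳ b

-- A first step u → y below u · (i , j) raises the rank function inside the rectangle
-- [i , j) × [u i , u j), and a tight rectangle contains no other point to start or end at.
tight⇒⋖ : {u : Permutation′ n} {i j : Fin n} → Tight u i j → u ⋖ (u · (i , j))
tight⇒⋖ {n} {u} {i} {j} t = [ step ] , λ x (u<x , x<v) → first u<x x<v
  where
  open Tight t
  v : Permutation′ n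
  v = u · (i , j)
  step : u →ᴮ v
  step = i , j , a<b , wa<wb , λ _ → refl
  module V = Step u v a<b wa<wb (λ _ → refl)

  no-two : ∀ {y} → u →ᴮ y → ¬ y <ᴮ v
  no-two {y} (k , l , k<l , uk<ul , y≈) y<v = ℕ.<-irrefl μ-eq (μ-decreases⁺ y<v)
    where
    module Y = Step u y k<l uk<ul y≈
    within : ∀ p q → k ≤ p → p < l → u ⟨$⟩ʳ k ≤ q → q < u ⟨$⟩ʳ l →
             (i ≤ p × p < j) × u ⟨$⟩ʳ i ≤ q × q < u ⟨$⟩ʳ j
    within p q k≤p p<l uk≤q q<ul =
      V.rank-outside p q (ℕ.<-≤-trans (Y.rank-inside p q k≤p p<l uk≤q q<ul) (rank-mono⁺ y<v p q))
    k≡i : k ≡ i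
    k≡i with within k (u ⟨$⟩ʳ k) ℕ.≤-refl k<l ℕ.≤-refl uk<ul | k ≟ i
    ... | _ | yes k≡i = k≡i
    ... | (i≤k , k<j) , ui≤uk , uk<uj | no k≢i = contradiction uk<uj
      (between k (Fin.≤∧≢⇒< i≤k (k≢i ∘ sym)) k<j (Fin.≤∧≢⇒< ui≤uk (k≢i ∘ sym ∘ injective u)))
    -- For the upper ends, the rectangle of the first step is tested at column `j` here, and at row
    -- `u j` below; the half-open rectangle of the cover contains neither.
    l≤j : l ≤ j
    l≤j = ℕ.≮⇒≥ λ j<l → Fin.<-irrefl refl (proj₂ (proj₁
      (within j (u ⟨$⟩ʳ k) (subst (_≤ j) (sym k≡i) (ℕ.<⇒≤ a<b)) j<l ℕ.≤-refl uk<ul)))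
    ul≤uj : u ⟨$⟩ʳ l ≤ u ⟨$⟩ʳ j
    ul≤uj = ℕ.≮⇒≥ λ uj<ul → Fin.<-irrefl refl (proj₂ (proj₂
      (within k (u ⟨$⟩ʳ j) ℕ.≤-refl k<l
        (subst (λ x → u ⟨$⟩ʳ x ≤ u ⟨$⟩ʳ j) (sym k≡i) (ℕ.<⇒≤ wa<wb)) uj<ul)))
    l≡j : l ≡ j
    l≡j with l ≟ j
    ... | yes l≡j = l≡j
    ... | no l≢j = contradiction (Fin.≤∧≢⇒< ul≤uj (l≢j ∘ injective u))
      (between l (subst (_< l) k≡i k<l) (Fin.≤∧≢⇒< l≤j l≢j)
        (subst (λ x → u ⟨$⟩ʳ x < u ⟨$⟩ʳ l) k≡i uk<ul))
    -- With both positions identified, `y` is `v` pointwise, which contradicts the strict decrease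
    -- of `μ` along `y <ᴮ v`.
    μ-eq : μ v ≡ μ y
    μ-eq = sum-cong-≗ λ m → cong (λ x → toℕ m * toℕ x)
      (sym (trans (y≈ m) (cong₂ (λ k l → (u · (k , l)) ⟨$⟩ʳ m) k≡i l≡j)))

  first : ∀ {x} → u <ᴮ x → ¬ x <ᴮ v
  first [ u→x ]       x<v = no-two u→x x<v
  first (u→y ∷ y<x)   x<v = no-two u→y (y<x ++ x<v)

-- Sorted prefixes

SortedBefore : Permutation′ n → Fin n → Set
SortedBefore w a = ∀ k → k < a → w ⟨$⟩ʳ k ≡ w₀ ⟨$⟩ʳ k

opposite-< : {i j : Fin n} → i < j → opposite j < opposite i
opposite-< {n} {i} {j} i<j = subst₂ ℕ._<_ (sym (Fin.opposite-prop j)) (sym (Fin.opposite-prop i))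
  (ℕ.∸-monoʳ-< (s≤s i<j) (Fin.toℕ<n j))

-- A value above `opposite a` is already taken: its `opposite` is a position before `a`, where the
-- sorted prefix puts exactly that value.
value≤opposite : (w : Permutation′ n) {a : Fin n} → SortedBefore w a →
                 ∀ {j} → a ≤ j → w ⟨$⟩ʳ j ≤ opposite a
value≤opposite w {a} sorted {j} a≤j = ℕ.≮⇒≥ λ oa<wj →
  let i<a = subst (opposite (w ⟨$⟩ʳ j) <_) (Fin.opposite-involutive a) (opposite-< oa<wj)
      i≡j = injective w (trans (sorted _ i<a) (Fin.opposite-involutive (w ⟨$⟩ʳ j)))
  in Fin.<-irrefl i≡j (ℕ.<-≤-trans i<a a≤j)

sorted-descends : (w : Permutation′ n) {k j : Fin n} → SortedBefore w k → w ⟨$⟩ʳ k ≡ w₀ ⟨$⟩ʳ k →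
                  k < j → w ⟨$⟩ʳ j < w ⟨$⟩ʳ k
sorted-descends w {k} {j} sorted wk k<j = Fin.≤∧≢⇒<
  (subst (w ⟨$⟩ʳ j ≤_) (sym wk) (value≤opposite w sorted (ℕ.<⇒≤ k<j)))
  (λ wj≡wk → Fin.<-irrefl (sym (injective w wj≡wk)) k<j)

firstUnsorted? : (w : Permutation′ n) → w ≈ w₀ ⊎ ∃[ a ] FirstUnsorted w a
firstUnsorted? w with Fin.all? (λ k → (w ⟨$⟩ʳ k) ≟ (w₀ ⟨$⟩ʳ k))
... | yes w≈w₀ = inj₁ w≈w₀
... | no  w≉w₀ = inj₂ (least (λ k → (w ⟨$⟩ʳ k) ≟ (w₀ ⟨$⟩ʳ k)) w≉w₀)

unsorted-below : (w : Permutation′ n) {a : Fin n} → FirstUnsorted w a → w ⟨$⟩ʳ a < opposite a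
unsorted-below w (wa≢ , sorted) = Fin.≤∧≢⇒< (value≤opposite w sorted ℕ.≤-refl) wa≢

greedyPair : (w : Permutation′ n) {a : Fin n} → FirstUnsorted w a → ∃[ b ] IsGreedyPair w (a , b)
greedyPair w {a} a! = b , a! , trans (cong toℕ (inverseʳ w)) (Fin.toℕ-fromℕ< v<n)
  where
  v<n = ℕ.≤-<-trans (unsorted-below w a!) (Fin.toℕ<n (opposite a))
  b = w ⟨$⟩ˡ fromℕ< v<n

greedy⇒tight : (w : Permutation′ n) {a b : Fin n} → IsGreedyPair w (a , b) → Tight w a b
greedy⇒tight w {a} {b} (a!@(_ , sorted) , wb) = tight a<b wa<wb
  λ m _ _ wa<wm wm<wb → ℕ.<-irrefl refl
    (ℕ.<-≤-trans wa<wm (ℕ.s≤s⁻¹ (subst (toℕ (w ⟨$⟩ʳ m) ℕ.<_) wb wm<wb)))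
  where
  wa<wb : w ⟨$⟩ʳ a < w ⟨$⟩ʳ b
  wa<wb = ℕ.≤-reflexive (sym wb)
  a<b : a < b
  a<b with Fin.<-cmp a b
  ... | tri< a<b _ _ = a<b
  ... | tri≈ _ refl _ = contradiction wa<wb (Fin.<-irrefl refl)
  -- A position before `a` carries a value above `opposite a`, whereas `w b = w a + 1` is at most
  -- `opposite a`.
  ... | tri> _ _ b<a = contradiction
    (subst (opposite a <_) (sym (sorted b b<a)) (opposite-< b<a))
    (ℕ.≤⇒≯ (subst (ℕ._≤ toℕ (opposite a)) (sym wb) (unsorted-below w a!)))

-- Longest increasing subsequences

Rise : Permutation′ n → Fin n → Fin n → Set
Rise w i j = i < j × w ⟨$⟩ʳ i < w ⟨$⟩ʳ j

Rise-trans : (w : Permutation′ n) → ∀ {i j k} → Rise w i j → Rise w j k → Rise w i k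
Rise-trans w (i<j , wi<wj) (j<k , wj<wk) = Fin.<-trans i<j j<k , Fin.<-trans wi<wj wj<wk

sorted-prefix : (w : Permutation′ n) {a k : Fin n} → SortedBefore w a → k < a → SortedBefore w k
sorted-prefix w sorted k<a j j<k = sorted j (Fin.<-trans j<k k<a)

found : Permutation′ n → Fin n → List (List (Fin n))
found w q = filter (increasingFrom? w q) (subsequences (allFin _))

∈-found : (w : Permutation′ n) {q : Fin n} {α : List (Fin n)} → IncreasingFrom w q α → α ∈ found w q
∈-found w {q} {α} inc = ∈-filter⁺ (increasingFrom? w q)
  (sorted⇒∈subsequences (tabulate⁺-< id)
    (AllPairs.map proj₁ (Linked⇒AllPairs (Rise-trans w) (proj₂ inc))) (All.universal ∈-allFin α))
  inc

-- Two successive maxima over a finite list: first the length, then the lexicographic order among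
-- the lists of that length. The default values `q ∷ []` and `longest` themselves have the property
-- sought, so it passes to the maxima.
lexLast : (w : Permutation′ n) (q : Fin n) → ∃[ γ ] LexLastLIS w q (q ∷ γ)
lexLast {n} w q = uncons top top-LIS top-last
  where
  module LexMax = Extrema (DecTotalOrder.totalOrder (Lex.≤-decTotalOrder (Fin.<-strictTotalOrder n)))
  longest : List (Fin n)
  longest = argmax length (q ∷ []) (found w q)
  longest-LIS : LIS w q longest
  longest-LIS =
    argmax-all length (refl , [-]) (all-filter (increasingFrom? w q) (subsequences (allFin n))) ,
    λ β inc → All.lookup (f[xs]≤f[argmax] (q ∷ []) (found w q)) (∈-found w inc)
  asLong? = λ (α : List (Fin n)) → length α ℕ.≟ length longest
  top : List (Fin n)
  top = LexMax.max longest (filter asLong? (found w q))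
  top-LIS : LIS w q top
  top-LIS = LexMax.argmax-all id {P = LIS w q} longest-LIS (All.tabulate λ α∈ →
    let α∈found , len≡ = ∈-filter⁻ asLong? α∈
    in proj₂ (∈-filter⁻ (increasingFrom? w q) {xs = subsequences (allFin n)} α∈found) ,
       λ β inc → subst (length β ℕ.≤_) (sym len≡) (proj₂ longest-LIS β inc))
  top-last : ∀ β → LIS w q β → Lex-≤ _≡_ _<_ β top
  top-last β (inc , max) = All.lookup (LexMax.xs≤max longest _) (∈-filter⁺ asLong? (∈-found w inc)
    (ℕ.≤-antisym (proj₂ longest-LIS β inc) (max longest (proj₁ longest-LIS))))
  uncons : ∀ α → LIS w q α → (∀ β → LIS w q β → Lex-≤ _≡_ _<_ β α) → ∃[ γ ] LexLastLIS w q (q ∷ γ)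
  uncons (_ ∷ γ) lis@((refl , _) , _) last = γ , lis , last

Lex-second : ∀ {a x y : Fin n} {β γ} → Lex-≤ _≡_ _<_ (a ∷ x ∷ β) (a ∷ y ∷ γ) → x ≤ y
Lex-second (this a<a)          = contradiction a<a (Fin.<-irrefl refl)
Lex-second (next _ (this x<y)) = ℕ.<⇒≤ x<y
Lex-second (next _ (next refl _)) = ℕ.≤-refl

length≤raj : (w : Permutation′ n) {q : Fin n} {γ : List (Fin n)} →
             Linked (Rise w) (q ∷ γ) → length γ ℕ.≤ rajcode‾ w q
length≤raj w {q} inc with lexLast w q
... | α , lis , _ = subst (_ ℕ.≤_) (sym (LIS-length w lis)) (ℕ.s≤s⁻¹ (proj₂ lis _ (refl , inc)))

-- A longest sequence of `w` is carried over to `w′`; `c` bounds the entries lost on the way and is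
-- 0 or 1 in all applications.
raj-mono : (w w′ : Permutation′ n) {q : Fin n} (c : ℕ) →
  (∀ γ → Linked (Rise w) (q ∷ γ) → ∃[ γ′ ] Linked (Rise w′) (q ∷ γ′) × length γ ℕ.≤ c + length γ′) →
  rajcode‾ w q ℕ.≤ c + rajcode‾ w′ q
raj-mono w w′ {q} c f with lexLast w q
... | α , lis@((_ , inc) , _) , _ with f α inc
... | γ′ , inc′ , len≤ = subst (ℕ._≤ _) (sym (LIS-length w lis))
  (ℕ.≤-trans len≤ (ℕ.+-monoʳ-≤ c (length≤raj w′ inc′)))

raj-sorted : (w : Permutation′ n) {k : Fin n} → SortedBefore w k → w ⟨$⟩ʳ k ≡ w₀ ⟨$⟩ʳ k →
             rajcode‾ w k ≡ 0
raj-sorted w {k} sorted wk with lexLast w k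
... | [] , lis , _ = LIS-length w lis
... | x ∷ _ , ((_ , (k<x , wk<wx) ∷ _) , _) , _ =
  contradiction wk<wx (Fin.<-asym (sorted-descends w sorted wk k<x))

invcode‾ : Permutation′ n → Fin n → ℕ
invcode‾ w k = #[ (λ j → (k <? j) ×-dec ((w ⟨$⟩ʳ k) <? (w ⟨$⟩ʳ j))) ]

invcode‾-Σ : (w : Permutation′ n) (k : Fin n) →
             invcode‾ w k ≡ Σ (λ j → ind ((k <? j) ×-dec ((w ⟨$⟩ʳ k) <? (w ⟨$⟩ʳ j))))
invcode‾-Σ w k = count≡Σ (λ j → (k <? j) ×-dec ((w ⟨$⟩ʳ k) <? (w ⟨$⟩ʳ j)))

invcode‾-cong : (w w′ : Permutation′ n) {k : Fin n} → (∀ {j} → Rise w k j → Rise w′ k j) →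
                (∀ {j} → Rise w′ k j → Rise w k j) → invcode‾ w k ≡ invcode‾ w′ k
invcode‾-cong w w′ {k} f g = trans (invcode‾-Σ w k) (trans
  (sum-cong-≗ λ j → ind-cong ((k <? j) ×-dec ((w ⟨$⟩ʳ k) <? (w ⟨$⟩ʳ j)))
                             ((k <? j) ×-dec ((w′ ⟨$⟩ʳ k) <? (w′ ⟨$⟩ʳ j))) f g)
  (sym (invcode‾-Σ w′ k)))

linked-map : ∀ {A : Set} {P : A → Set} {R S : A → A → Set} → (∀ {x y} → P x → P y → R x y → S x y) →
             ∀ {xs} → All P xs → Linked R xs → Linked S xs
linked-map f _              []          = []
linked-map f _              [-]         = [-]
linked-map f (px ∷ py ∷ ps) (Rxy ∷ Rxs) = f px py Rxy ∷ linked-map f (py ∷ ps) Rxs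

linked-above : {R S : Fin n → Fin n → Set} {a x : Fin n} {γ : List (Fin n)} →
  (∀ {x y} → a < x → a < y → R x y → S x y) → a < x → (∀ {x y} → R x y → x < y) →
  Linked R (x ∷ γ) → Linked S (x ∷ γ)
linked-above f a<x R⇒< [-]         = [-]
linked-above f a<x R⇒< (Rxy ∷ Rxs) = f a<x a<y Rxy ∷ linked-above f a<y R⇒< Rxs
  where a<y = Fin.<-trans a<x (R⇒< Rxy)

rises : (w : Permutation′ n) {x : Fin n} {γ : List (Fin n)} →
        Linked (Rise w) (x ∷ γ) → All (Rise w x) γ
rises w inc = AllPairs.head (Linked⇒AllPairs (Rise-trans w) inc)

-- Exchanging the values in the positions of a tight pair

module Exchange (w : Permutation′ n) {a b : Fin n} (t : Tight w a b) where
  open Tight t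

  w′ : Permutation′ n
  w′ = w · (a , b)

  Between : Fin n → Set
  Between m = w ⟨$⟩ʳ a < w ⟨$⟩ʳ m × w ⟨$⟩ʳ m < w ⟨$⟩ʳ b

  w′a : w′ ⟨$⟩ʳ a ≡ w ⟨$⟩ʳ b
  w′a = ·-left w a b

  w′b : w′ ⟨$⟩ʳ b ≡ w ⟨$⟩ʳ a
  w′b = ·-right w a b

  w′≗w : ∀ {j} → j ≢ a → j ≢ b → w′ ⟨$⟩ʳ j ≡ w ⟨$⟩ʳ j
  w′≗w = ·-other w

  -- Away from `a` only the value at `b` changes, falling from `w b` to `w a`. So the only rise that
  -- can be lost is one into `b` from a value in between; dually, `reflect` has to exclude a rise
  -- out of `b` to such a value.
  preserve : ∀ {x y} → x ≢ a → y ≢ a → (y ≡ b → ¬ Between x) →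
             w ⟨$⟩ʳ x < w ⟨$⟩ʳ y → w′ ⟨$⟩ʳ x < w′ ⟨$⟩ʳ y
  preserve {x} {y} x≢a y≢a gap wx<wy with x ≟ b | y ≟ b
  ... | yes refl | yes refl = contradiction wx<wy (Fin.<-irrefl refl)
  ... | yes refl | no y≢b   = subst₂ _<_ (sym w′b) (sym (w′≗w y≢a y≢b)) (Fin.<-trans wa<wb wx<wy)
  ... | no x≢b   | no y≢b   = subst₂ _<_ (sym (w′≗w x≢a x≢b)) (sym (w′≗w y≢a y≢b)) wx<wy
  ... | no x≢b   | yes refl = subst₂ _<_ (sym (w′≗w x≢a x≢b)) (sym w′b)
    (Fin.≤∧≢⇒< (ℕ.≮⇒≥ λ wa<wx → gap refl (wa<wx , wx<wy)) (x≢a ∘ injective w))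

  reflect : ∀ {x y} → x ≢ a → y ≢ a → (x ≡ b → ¬ Between y) →
            w′ ⟨$⟩ʳ x < w′ ⟨$⟩ʳ y → w ⟨$⟩ʳ x < w ⟨$⟩ʳ y
  reflect {x} {y} x≢a y≢a gap w′x<w′y with x ≟ b | y ≟ b
  ... | yes refl | yes refl = contradiction w′x<w′y (Fin.<-irrefl refl)
  ... | no x≢b   | yes refl = Fin.<-trans (subst₂ _<_ (w′≗w x≢a x≢b) w′b w′x<w′y) wa<wb
  ... | no x≢b   | no y≢b   = subst₂ _<_ (w′≗w x≢a x≢b) (w′≗w y≢a y≢b) w′x<w′y
  ... | yes refl | no y≢b   = Fin.≤∧≢⇒<
    (ℕ.≮⇒≥ λ wy<wb → gap refl (subst₂ _<_ w′b (w′≗w y≢a y≢b) w′x<w′y , wy<wb))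
    (y≢b ∘ sym ∘ injective w)

  above : ∀ {k} → a < k → k ≢ a
  above a<k refl = Fin.<-irrefl refl a<k

  before : ∀ {k} → k < a → w′ ⟨$⟩ʳ k ≡ w ⟨$⟩ʳ k
  before k<a = w′≗w (λ { refl → Fin.<-irrefl refl k<a }) (λ { refl → Fin.<-asym k<a a<b })

  sorted′ : SortedBefore w a → SortedBefore w′ a
  sorted′ sorted k k<a = trans (before k<a) (sorted k k<a)

  avoid : ∀ {x γ} → a < x → w ⟨$⟩ʳ b ≤ w ⟨$⟩ʳ x → All (Rise w x) γ →
          All (λ j → w′ ⟨$⟩ʳ j ≡ w ⟨$⟩ʳ j) γ
  avoid a<x wb≤wx = All.map λ (x<j , wx<wj) → w′≗w
    (above (Fin.<-trans a<x x<j)) (λ { refl → ℕ.<⇒≱ wx<wj wb≤wx })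

  -- In `w′` position `a` carries `w b`, which is at most `w x`, so `a` can stand in for `x`. The
  -- later entries exceed `w b` in `w` and hence are untouched by the exchange. This is why
  -- `rajcode‾` at `a` drops by at most one.
  drop-second : ∀ {x γ} → a < x → w ⟨$⟩ʳ b ≤ w ⟨$⟩ʳ x → Linked (Rise w) (x ∷ γ) →
                Linked (Rise w′) (a ∷ γ)
  drop-second a<x wb≤wx [-] = [-]
  drop-second a<x wb≤wx inc@((x<y , wx<wy) ∷ inc-y) with avoid a<x wb≤wx (rises w inc)
  ... | same@(w′y ∷ _) =
    (Fin.<-trans a<x x<y , subst₂ _<_ (sym w′a) (sym w′y) (ℕ.≤-<-trans wb≤wx wx<wy)) ∷
    linked-map (λ eqx eqy (x<y , lt) → x<y , subst₂ _<_ (sym eqx) (sym eqy) lt) same inc-y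

  -- The later entries exceed `w′ a = w b` in `w′`, so none of them is `b` and all keep their
  -- values, while the value at `a` only gets smaller in `w`.
  lower : ∀ {γ} → Linked (Rise w′) (a ∷ γ) → Linked (Rise w) (a ∷ γ)
  lower [-] = [-]
  lower inc@((a<y , w′a<w′y) ∷ inc-y) with All.map
      (λ (a<j , w′a<w′j) → w′≗w (above a<j)
        (λ { refl → Fin.<-asym wa<wb (subst₂ _<_ w′a w′b w′a<w′j) })) (rises w′ inc)
  ... | same@(w′y ∷ _) = (a<y , Fin.<-trans wa<wb (subst₂ _<_ w′a w′y w′a<w′y)) ∷
    linked-map (λ eqx eqy (x<y , lt) → x<y , subst₂ _<_ eqx eqy lt) same inc-y

  raj-le : rajcode‾ w′ a ℕ.≤ rajcode‾ w a
  raj-le = raj-mono w′ w 0 λ γ inc → γ , lower inc , ℕ.≤-refl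

  raj-before : SortedBefore w a → ∀ {k} → k < a → rajcode‾ w′ k ≡ rajcode‾ w k
  raj-before sorted {k} k<a = trans
    (raj-sorted w′ (sorted-prefix w′ (sorted′ sorted) k<a) (sorted′ sorted k k<a))
    (sym (raj-sorted w (sorted-prefix w sorted k<a) (sorted k k<a)))

invcode‾-sorted : (w : Permutation′ n) {k : Fin n} → SortedBefore w k → w ⟨$⟩ʳ k ≡ w₀ ⟨$⟩ʳ k →
                  invcode‾ w k ≡ 0
invcode‾-sorted {n} w {k} sorted wk = trans (invcode‾-Σ w k) (trans
  (sum-cong-≗ λ j → ind-no ((k <? j) ×-dec ((w ⟨$⟩ʳ k) <? (w ⟨$⟩ʳ j)))
    (λ (k<j , wk<wj) → Fin.<-asym (sorted-descends w sorted wk k<j) wk<wj))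
  (sum-replicate-zero n))

-- Effect of a greedy exchange on `rajcode‾` and `invcode‾`

module GreedyStep (w : Permutation′ n) {a b : Fin n} (greedy : IsGreedyPair w (a , b)) where
  open Exchange w (greedy⇒tight w greedy) public
  open Tight (greedy⇒tight w greedy)

  private
    sorted : SortedBefore w a
    sorted = proj₂ (proj₁ greedy)

    adjacent : ∀ {m} → w ⟨$⟩ʳ a < w ⟨$⟩ʳ m → w ⟨$⟩ʳ b ≤ w ⟨$⟩ʳ m
    adjacent wa<wm = subst (ℕ._≤ _) (sym (proj₂ greedy)) wa<wm

    none : ∀ {m} → ¬ Between m
    none (wa<wm , wm<wb) = ℕ.<⇒≱ wm<wb (adjacent wa<wm)

    rise⇒ : ∀ {x y} → a < x → a < y → Rise w x y → Rise w′ x y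
    rise⇒ a<x a<y (x<y , lt) = x<y , preserve (above a<x) (above a<y) (λ _ → none) lt

    rise⇐ : ∀ {x y} → a < x → a < y → Rise w′ x y → Rise w x y
    rise⇐ a<x a<y (x<y , lt) = x<y , reflect (above a<x) (above a<y) (λ _ → none) lt

  raj-off : ∀ k → k ≢ a → rajcode‾ w′ k ≡ rajcode‾ w k
  raj-off k k≢a with Fin.<-cmp k a
  ... | tri≈ _ k≡a _ = contradiction k≡a k≢a
  ... | tri< k<a _ _ = raj-before sorted k<a
  ... | tri> _ _ a<k = ℕ.≤-antisym
    (raj-mono w′ w 0 λ γ inc → γ , linked-above rise⇐ a<k proj₁ inc , ℕ.≤-refl)
    (raj-mono w w′ 0 λ γ inc → γ , linked-above rise⇒ a<k proj₁ inc , ℕ.≤-refl)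

  raj-suc : rajcode‾ w a ℕ.≤ suc (rajcode‾ w′ a)
  raj-suc = raj-mono w w′ 1 λ where
    []      _                        → [] , [-] , z≤n
    (x ∷ γ) ((a<x , wa<wx) ∷ inc) → γ , drop-second a<x (adjacent wa<wx) inc , ℕ.≤-refl

  invcode‾-off : ∀ k → k ≢ a → invcode‾ w′ k ≡ invcode‾ w k
  invcode‾-off k k≢a with Fin.<-cmp k a
  ... | tri≈ _ k≡a _ = contradiction k≡a k≢a
  ... | tri> _ _ a<k = invcode‾-cong w′ w
    (λ r@(k<j , _) → rise⇐ a<k (Fin.<-trans a<k k<j) r)
    (λ r@(k<j , _) → rise⇒ a<k (Fin.<-trans a<k k<j) r)
  ... | tri< k<a _ _ = trans
    (invcode‾-sorted w′ (sorted-prefix w′ (sorted′ sorted) k<a) (sorted′ sorted k k<a))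
    (sym (invcode‾-sorted w (sorted-prefix w sorted k<a) (sorted k k<a)))

  invcode‾-at : invcode‾ w a ≡ suc (invcode‾ w′ a)
  invcode‾-at = begin
    invcode‾ w a                 ≡⟨ invcode‾-Σ w a ⟩
    Σ f                          ≡⟨ ℕ.+-identityʳ (Σ f) ⟨
    Σ f + 0                      ≡⟨ cong (Σ f ℕ.+_) gb ⟨
    Σ f + g b                    ≡⟨ Σ-update b same ⟨
    Σ g + f b                    ≡⟨ cong (Σ g ℕ.+_) fb ⟩
    Σ g + 1                      ≡⟨ ℕ.+-comm (Σ g) 1 ⟩
    suc (Σ g)                    ≡⟨ cong suc (invcode‾-Σ w′ a) ⟨
    suc (invcode‾ w′ a)          ∎
    where
    open ≡-Reasoning
    f? = λ j → (a <? j) ×-dec ((w ⟨$⟩ʳ a) <? (w ⟨$⟩ʳ j))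
    g? = λ j → (a <? j) ×-dec ((w′ ⟨$⟩ʳ a) <? (w′ ⟨$⟩ʳ j))
    f g : Fin _ → ℕ
    f j = ind (f? j)
    g j = ind (g? j)
    fb : f b ≡ 1
    fb = ind-yes (f? b) (a<b , wa<wb)
    gb : g b ≡ 0
    gb = ind-no (g? b) λ (_ , lt) → Fin.<-asym wa<wb (subst₂ _<_ w′a w′b lt)
    -- As `w b` is the next value after `w a`, exceeding `w a` and exceeding `w b` differ only at
    -- position `b`.
    same : ∀ j → j ≢ b → f j ≡ g j
    same j j≢b = ind-cong (f? j) (g? j)
      (λ (a<j , lt) → a<j , subst₂ _<_ (sym w′a) (sym (w′≗w (above a<j) j≢b))
        (Fin.≤∧≢⇒< (adjacent lt) (j≢b ∘ sym ∘ injective w)))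
      (λ (a<j , lt) → a<j , Fin.<-trans wa<wb (subst₂ _<_ w′a (w′≗w (above a<j) j≢b) lt))

-- Effect of a nested exchange on `rajcode‾`

nested⇒tight : (w : Permutation′ n) {a b : Fin n} {γ : List (Fin n)} →
               LIS w a (a ∷ b ∷ γ) → Tight w a b
nested⇒tight w {a} {b} {γ} ((_ , (a<b , wa<wb) ∷ inc) , longest) = tight a<b wa<wb
  λ m a<m m<b wa<wm wm<wb → ℕ.1+n≰n
    (longest (a ∷ m ∷ b ∷ γ) (refl , (a<m , wa<wm) ∷ (m<b , wm<wb) ∷ inc))

module NestedStep (w : Permutation′ n) {a b : Fin n} {γ : List (Fin n)} (sorted : SortedBefore w a)
                  (lexLastLIS : LexLastLIS w a (a ∷ b ∷ γ)) where
  private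
    lis : LIS w a (a ∷ b ∷ γ)
    lis = proj₁ lexLastLIS

    tail : Linked (Rise w) (b ∷ γ)
    tail = Linked.tail (proj₂ (proj₁ lis))

    t : Tight w a b
    t = nested⇒tight w lis

  open Exchange w t public
  open Tight t

  LIS-second≤ : ∀ {c δ} → LIS w a (a ∷ c ∷ δ) → c ≤ b
  LIS-second≤ lis′ = Lex-second (proj₂ lexLastLIS _ lis′)

  unaffected : ∀ {x y} → b < x → b < y → Rise w′ x y → Rise w x y
  unaffected b<x b<y (x<y , lt) = x<y , reflect
    (above (Fin.<-trans a<b b<x)) (above (Fin.<-trans a<b b<y))
    (λ { refl → contradiction b<x (Fin.<-irrefl refl) }) lt

  -- If an increasing sequence in w′ continues from position b to a position y with
  -- w a < w y < w b, its part after b is shorter than γ, because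
  -- a ∷ b ∷ γ was lexicographically last.
  raise : ∀ {x} β → a < x → Linked (Rise w′) (x ∷ β) →
          ∃[ β′ ] Linked (Rise w) (x ∷ β′) × length β ℕ.≤ length β′
  raise []              a<x [-] = [] , [-] , z≤n
  raise {x} (y ∷ β) a<x ((x<y , w′x<w′y) ∷ inc) with x ≟ b
  ... | no x≢b = let β′ , inc′ , len≤ = raise β a<y inc
                     wx<wy = reflect (above a<x) (above a<y) (λ x≡b → contradiction x≡b x≢b) w′x<w′y
                 in y ∷ β′ , (x<y , wx<wy) ∷ inc′ , s≤s len≤
    where a<y = Fin.<-trans a<x x<y
  ... | yes refl with Fin.<-cmp (w ⟨$⟩ʳ b) (w ⟨$⟩ʳ y)
  ...   | tri< wb<wy _ _ = y ∷ β , (x<y , wb<wy) ∷ linked-above unaffected x<y proj₁ inc , ℕ.≤-refl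
  ...   | tri≈ _ wb≡wy _ = contradiction x<y (Fin.<-irrefl (injective w wb≡wy))
  ...   | tri> _ _ wy<wb = γ , tail , ℕ.≮⇒≥ too-long
    where
    a<y = Fin.<-trans a<b x<y
    inc-y : IncreasingFrom w a (a ∷ y ∷ β)
    inc-y = refl , (a<y , subst₂ _<_ w′b (w′≗w (above a<y) λ { refl → Fin.<-irrefl refl x<y }) w′x<w′y)
                   ∷ linked-above unaffected x<y proj₁ inc
    too-long : ¬ length γ ℕ.< length (y ∷ β)
    too-long γ<yβ = ℕ.<⇒≱ x<y
      (LIS-second≤ (inc-y , λ δ incδ → ℕ.≤-trans (proj₂ lis δ incδ) (s≤s γ<yβ)))

  raj-off : ∀ k → k ≢ a → rajcode‾ w′ k ≡ rajcode‾ w k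
  raj-off k k≢a with Fin.<-cmp k a
  ... | tri≈ _ k≡a _ = contradiction k≡a k≢a
  ... | tri< k<a _ _ = raj-before sorted k<a
  ... | tri> _ _ a<k = ℕ.≤-antisym
    (raj-mono w′ w 0 λ β → raise β a<k)
    (raj-mono w w′ 0 λ β inc → β , linked-above rise⇒ a<k proj₁ inc , ℕ.≤-refl)
    where
    -- A rise into `b` from a value in between would start inside the tight rectangle, so no rise
    -- after `a` is lost.
    rise⇒ : ∀ {x y} → a < x → a < y → Rise w x y → Rise w′ x y
    rise⇒ a<x a<y (x<y , lt) = x<y , preserve (above a<x) (above a<y)
      (λ { refl (wa<wx , wx<wb) → between _ a<x x<y wa<wx wx<wb }) lt

  raj-at : rajcode‾ w a ≡ suc (length γ)
  raj-at = LIS-length w lis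

  increasing′ : IncreasingFrom w′ a (a ∷ γ)
  increasing′ = refl , drop-second a<b ℕ.≤-refl tail

  raj-suc : rajcode‾ w a ℕ.≤ suc (rajcode‾ w′ a)
  raj-suc = subst (ℕ._≤ suc (rajcode‾ w′ a)) (sym raj-at) (s≤s (length≤raj w′ (proj₂ increasing′)))

  module _ {b′ : Fin n} {γ′ : List (Fin n)} (lexLastLIS′ : LexLastLIS w′ a (a ∷ b′ ∷ γ′)) where

    private
      lis′ : LIS w′ a (a ∷ b′ ∷ γ′)
      lis′ = proj₁ lexLastLIS′

      raj-at′ : rajcode‾ w′ a ≡ suc (length γ′)
      raj-at′ = LIS-length w′ lis′

    -- Without a drop, the next nested sequence, read in `w` by means of `lower`, would be a longest
    -- one whose second entry lies beyond `b`.
    raj-ascent : b < b′ → rajcode‾ w a ≡ suc (rajcode‾ w′ a)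
    raj-ascent b<b′ = ℕ.≤-antisym raj-suc (ℕ.≤∧≢⇒< raj-le λ eq → ℕ.<⇒≱ b<b′
      (LIS-second≤ ((refl , lower (proj₂ (proj₁ lis′))) , λ δ incδ → ℕ.≤-trans (proj₂ lis δ incδ)
        (s≤s (ℕ.≤-reflexive (trans (sym raj-at) (trans (sym eq) raj-at′)))))))

    -- After a drop, `a ∷ γ` is already a longest sequence of `w′`. Its second entry lies beyond
    -- `b`, and `b′` is at least that entry, so the link would be an ascent.
    raj-descent : ¬ b < b′ → rajcode‾ w a ≡ rajcode‾ w′ a
    raj-descent b≮b′ = ℕ.≤-antisym (ℕ.≮⇒≥ drops) raj-le
      where
      drops : ¬ rajcode‾ w′ a ℕ.< rajcode‾ w a
      drops lt = b≮b′ (go γ tail increasing′ (subst₂ ℕ._<_ raj-at′ raj-at lt))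
        where
        go : ∀ γ → Linked (Rise w) (b ∷ γ) → IncreasingFrom w′ a (a ∷ γ) →
             suc (length γ′) ℕ.< suc (length γ) → b < b′
        go []      _             _   (s≤s ())
        go (c ∷ γ) ((b<c , _) ∷ _) inc (s≤s len<) = ℕ.<-≤-trans b<c
          (Lex-second (proj₂ lexLastLIS′ (a ∷ c ∷ γ)
            (inc , λ δ incδ → ℕ.≤-trans (proj₂ lis′ δ incδ) (s≤s len<))))

tight-μ : (w : Permutation′ n) {a b : Fin n} → Tight w a b → μ (w · (a , b)) ℕ.< μ w
tight-μ w {a} {b} t = Step.μ-decreases w (w · (a , b)) (Tight.a<b t) (Tight.wa<wb t) (λ _ → refl)

μ-rec : (P : Permutation′ n → Set) → (∀ w → (∀ v → μ v ℕ.< μ w → P v) → P w) → ∀ w → P w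
μ-rec P step = WF.All.wfRec (On.wellFounded μ <-wellFounded) 0ℓ P λ w rec → step w (λ v v<w → rec v<w)

-- Interpolating chains, link by link

-- Here and in `Interpolating` the ordering, climbing and covering conditions are left out: greedy
-- and nested links imply them, and `climb` restores them one link at a time.
data NestedChain (w : Permutation′ n) : List (Link n) → Set where
  noLinks : w ≈ w₀ → NestedChain w []
  nestedLink : IsNestedPair w c → NestedChain (w · c) C → NestedChain w (c ∷ C)

data Interpolating (w : Permutation′ n) : ℕ → List (Link n) → Set where
  nestedTail : NestedChain w C → Interpolating w (length C) C
  greedyLink : IsGreedyPair w c → Interpolating (w · c) p C → Interpolating w p (c ∷ C)

p≤length : Interpolating w p C → p ℕ.≤ length C
p≤length (nestedTail _)   = ℕ.≤-refl
p≤length (greedyLink _ i) = ℕ.m≤n⇒m≤1+n (p≤length i)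

fromNested : ∀ (w : Permutation′ n) C → (w ·· C) ≈ w₀ →
  (∀ (q : Fin (length C)) → IsNestedPair (w ·· take (toℕ q) C) (lookup C q)) → NestedChain w C
fromNested w []      w≈w₀ _  = noLinks w≈w₀
fromNested w (c ∷ C) ends nest = nestedLink (nest zero) (fromNested (w · c) C ends (nest ∘ suc))

fromLinks : ∀ (w : Permutation′ n) p C → (w ·· C) ≈ w₀ → p ℕ.≤ length C →
  (∀ (q : Fin (length C)) → toℕ q ℕ.< length C ∸ p → IsGreedyPair (w ·· take (toℕ q) C) (lookup C q)) →
  (∀ (q : Fin (length C)) → length C ∸ p ℕ.≤ toℕ q → IsNestedPair (w ·· take (toℕ q) C) (lookup C q)) →
  Interpolating w p C
fromLinks w .0 []     w≈w₀ z≤n _   _    = nestedTail (noLinks w≈w₀)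
fromLinks w p (c ∷ C) ends p≤ gree nest with p ℕ.≤? length C
... | yes p≤len = greedyLink (gree zero (subst (0 ℕ.<_) (sym shift) (s≤s z≤n)))
  (fromLinks (w · c) p C ends p≤len
    (λ q q< → gree (suc q) (subst (suc (toℕ q) ℕ.<_) (sym shift) (s≤s q<)))
    (λ q ≤q → nest (suc q) (subst (ℕ._≤ suc (toℕ q)) (sym shift) (s≤s ≤q))))
  where
  shift : suc (length C) ∸ p ≡ suc (length C ∸ p)
  shift = ℕ.+-∸-assoc 1 p≤len
-- Now `p` is the full length, so no greedy link remains.
... | no p≰len with ℕ.≤-antisym p≤ (ℕ.≰⇒> p≰len)
...   | refl = nestedTail (fromNested w (c ∷ C) ends
  λ q → nest q (subst (ℕ._≤ toℕ q) (sym (ℕ.n∸n≡0 (length C))) z≤n))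

fromChain : IsInterpolatingChain w p C → Interpolating w p C
fromChain {w = w} {p} {C} i =
  fromLinks w p C (IsClimbingChain.reaches isClimbingChain) k≤length greedy nested
  where open IsInterpolatingChain i

-- The source of the climbing condition: the exchange leaves the sorted prefix before `a` intact.
unsorted-mono : (w : Permutation′ n) {a b a′ : Fin n} → Tight w a b → FirstUnsorted w a →
                FirstUnsorted (w · (a , b)) a′ → a ≤ a′
unsorted-mono w t (_ , sorted) (w′a′≢ , _) = ℕ.≮⇒≥ λ a′<a →
  w′a′≢ (Exchange.sorted′ w t sorted _ a′<a)

climb : (w : Permutation′ n) {a b : Fin n} → Tight w a b → FirstUnsorted w a →
  (∀ {c C′} → C ≡ c ∷ C′ → FirstUnsorted (w · (a , b)) (proj₁ c)) →
  IsClimbingChain (w · (a , b)) C → IsClimbingChain w ((a , b) ∷ C)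
climb {C = C} w {a} {b} t a! starts chain = record
  { ordered  = Tight.a<b t ∷ ordered
  ; climbing = link C starts climbing
  ; reaches  = reaches
  ; covers   = λ { zero → tight⇒⋖ t ; (suc q) → covers q }
  }
  where
  open IsClimbingChain chain
  link : ∀ C → (∀ {c C′} → C ≡ c ∷ C′ → FirstUnsorted (w · (a , b)) (proj₁ c)) →
         Linked (λ (i , _) (i′ , _) → i ≤ i′) C → Linked (λ (i , _) (i′ , _) → i ≤ i′) ((a , b) ∷ C)
  link []       _      _  = [-]
  link (c ∷ C) starts ls = unsorted-mono w t a! (starts refl) ∷ ls

nested-starts : NestedChain w C → ∀ {c C′} → C ≡ c ∷ C′ → FirstUnsorted w (proj₁ c)
nested-starts (nestedLink (a! , _) _) refl = a!

starts : Interpolating w p C → ∀ {c C′} → C ≡ c ∷ C′ → FirstUnsorted w (proj₁ c)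
starts (nestedTail i)          eq   = nested-starts i eq
starts (greedyLink (a! , _) _) refl = a!

toNested : NestedChain w C → IsInterpolatingChain w (length C) C
toNested (noLinks w≈w₀) = record
  { isClimbingChain = record { ordered = [] ; climbing = [] ; reaches = w≈w₀ ; covers = λ () }
  ; k≤length = z≤n
  ; greedy   = λ ()
  ; nested   = λ ()
  }
toNested {w = w} {C = _ ∷ C} (nestedLink pair@(a! , _ , last) rest) = record
  { isClimbingChain = climb w (nested⇒tight w (proj₁ last)) a! (nested-starts rest) isClimbingChain
  ; k≤length = ℕ.≤-refl
  ; greedy   = λ q q< → contradiction (subst (toℕ q ℕ.<_) (ℕ.n∸n≡0 (length C)) q<) ℕ.n≮0
  ; nested   = λ { zero    _ → pair
                 ; (suc q) _ → nested q (subst (ℕ._≤ toℕ q) (sym (ℕ.n∸n≡0 (length C))) z≤n) }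
  }
  where open IsInterpolatingChain (toNested rest)

toChain : Interpolating w p C → IsInterpolatingChain w p C
toChain (nestedTail i) = toNested i
toChain {w = w} {p} {_ ∷ C} (greedyLink pair@(a! , _) rest) = record
  { isClimbingChain = climb w (greedy⇒tight w pair) a! (starts rest) isClimbingChain
  ; k≤length = ℕ.m≤n⇒m≤1+n k≤length
  ; greedy   = λ { zero _ → pair
                 ; (suc q) q< → greedy q (ℕ.s≤s⁻¹ (subst (suc (toℕ q) ℕ.<_) shift q<)) }
  ; nested   = λ { zero ≤0 → contradiction (subst (ℕ._≤ 0) shift ≤0) ℕ.n≮0
                 ; (suc q) ≤q → nested q (ℕ.s≤s⁻¹ (subst (ℕ._≤ suc (toℕ q)) shift ≤q)) }
  }
  where
  open IsInterpolatingChain (toChain rest)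
  shift : suc (length C) ∸ p ≡ suc (length C ∸ p)
  shift = ℕ.+-∸-assoc 1 k≤length

-- Counting marked links

marks : (C : List (Link n)) → Subset (length C) → Fin n → ℕ
marks C S k = #[ (λ q → (q ∈? S) ×-dec (proj₁ (lookup C q) ≟ k)) ]

marks-∷ : ∀ (c : Link n) C s S k →
          marks (c ∷ C) (s ∷ S) k ≡ (if s then ind (proj₁ c ≟ k) else 0) + marks C S k
marks-∷ c C s S k = trans (count≡Σ (λ q → (q ∈? (s ∷ S)) ×-dec (proj₁ (lookup (c ∷ C) q) ≟ k)))
  (cong₂ _+_ (first s) (sym (count≡Σ (λ q → (q ∈? S) ×-dec (proj₁ (lookup C q) ≟ k)))))
  where
  first : ∀ s → ind ((zero ∈? (s ∷ S)) ×-dec (proj₁ c ≟ k)) ≡ (if s then ind (proj₁ c ≟ k) else 0)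
  first true  = refl
  first false = refl

-- The reason for the `+ 1` in the marking. Removing `c` changes the minimal mark of the following
-- link from `ascends c c′` to `true`; the extra forced mark covers that link even when `c` is the
-- last greedy one, so the marking restricts to the rest of the chain.
U-∷ : ∀ (c : Link n) C → p ℕ.≤ length C → U p (c ∷ C) ≡ true ∷ U p C
U-∷ {p = zero}  c C        _    = refl
U-∷ {p = suc p} c (c′ ∷ C) p≤ rewrite ℕ.+-∸-assoc 1 p≤ | ℕ.+-comm (length C ∸ p) 1 =
  cong (λ s → true ∷ s ∷ _) (∨-zeroʳ _)

firstLinks-zero : (C : List (Link n)) → firstLinks 0 C ≡ ⊥
firstLinks-zero []      = refl
firstLinks-zero (c ∷ C) = cong (false ∷_) (firstLinks-zero C)

-- With all links nested, the only forced mark is on the first link, which is minimal anyway.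
U-length : (C : List (Link n)) → U (length C) C ≡ M C
U-length []      = refl
U-length (c ∷ C) rewrite ℕ.n∸n≡0 (length C) =
  cong (true ∷_) (trans (cong (minimalAfter c C ∪_) (firstLinks-zero C)) (∪-identityʳ _))

-- Removing the first link changes only the mark of the second, from `ascent` to `true`. If both
-- links start at `a`, the count at `a` thus drops by one exactly at an ascent, in step with
-- `raj-ascent` and `raj-descent`. If the next link starts later or there is none, `rajcode‾` at `a`
-- is 0 after the exchange and hence 1 before it.
marks-nested : (w : Permutation′ n) {C : List (Link n)} → NestedChain w C →
               ∀ k → marks C (M C) k ≡ rajcode‾ w k
marks-nested w (noLinks w≈w₀) k = sym (raj-sorted w (λ j _ → w≈w₀ j) (w≈w₀ k))
marks-nested w {(a , b) ∷ C} (nestedLink (a! , γ , last) rest) k =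
  trans (marks-∷ (a , b) C true (minimalAfter (a , b) C) k) (by-next rest)
  where
  open NestedStep w (proj₂ a!) last
  w′a-sorted : ∀ {a′} → FirstUnsorted w′ a′ → a < a′ → rajcode‾ w′ a ≡ 0
  w′a-sorted (_ , sorted) a<a′ = raj-sorted w′ (sorted-prefix w′ sorted a<a′) (sorted a a<a′)
  drops-to-zero : rajcode‾ w′ a ≡ 0 → rajcode‾ w a ≡ 1
  drops-to-zero eq = ℕ.≤-antisym (subst (λ r → rajcode‾ w a ℕ.≤ suc r) eq raj-suc)
    (subst (1 ℕ.≤_) (sym raj-at) (s≤s z≤n))
  by-next : ∀ {C} → NestedChain w′ C →
            ind (a ≟ k) + marks C (minimalAfter (a , b) C) k ≡ rajcode‾ w k
  by-next (noLinks w′≈w₀) with a ≟ k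
  ... | yes refl = sym (drops-to-zero (raj-sorted w′ (λ j _ → w′≈w₀ j) (w′≈w₀ k)))
  ... | no a≢k   = trans (sym (raj-sorted w′ (λ j _ → w′≈w₀ j) (w′≈w₀ k))) (raj-off k (a≢k ∘ sym))
  by-next {(a′ , b′) ∷ C} i@(nestedLink (a′! , γ′ , last′) _) =
    trans (cong (ind (a ≟ k) ℕ.+_) (marks-∷ (a′ , b′) C ascent (minimalAfter (a′ , b′) C) k))
      (compare (trans (sym (marks-∷ (a′ , b′) C true _ k)) (marks-nested w′ i k)))
    where
    X = marks C (minimalAfter (a′ , b′) C) k
    ascent? = (a <? a′) ⊎-dec ((a ≟ a′) ×-dec (b <? b′))
    ascent = does ascent?
    compare : ind (a′ ≟ k) + X ≡ rajcode‾ w′ k →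
              ind (a ≟ k) + ((if ascent then ind (a′ ≟ k) else 0) + X) ≡ rajcode‾ w k
    compare eq with Fin.<-cmp a a′
    ... | tri> _ _ a′<a = contradiction a′<a
      (ℕ.≤⇒≯ (unsorted-mono w (nested⇒tight w (proj₁ last)) a! a′!))
    ... | tri< a<a′ _ _ rewrite dec-true ascent? (inj₁ a<a′) with a ≟ k
    ...   | yes refl = trans (cong suc (trans eq (w′a-sorted a′! a<a′)))
      (sym (drops-to-zero (w′a-sorted a′! a<a′)))
    ...   | no a≢k   = trans eq (raj-off k (a≢k ∘ sym))
    compare eq | tri≈ _ refl _ with a ≟ k
    ...   | no a≢k = trans (cong (_+ X) (if-eta ascent)) (trans eq (raj-off k (a≢k ∘ sym)))
    ...   | yes refl with b <? b′
    ...     | yes b<b′ = trans (cong (λ s → suc ((if s then 1 else 0) + X))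
                             (dec-true ascent? (inj₂ (refl , b<b′))))
                           (trans (cong suc eq) (sym (raj-ascent last′ b<b′)))
    ...     | no b≮b′  = trans (cong (λ s → suc ((if s then 1 else 0) + X)) 
                             (dec-false ascent? [ Fin.<-irrefl refl , b≮b′ ∘ proj₂ ]′))
                           (trans eq (sym (raj-descent last′ b≮b′)))

-- Existence of nested chains and comparison of the two codes

nestedChain : (w : Permutation′ n) → ∃[ C ] NestedChain w C
nestedChain {n} = μ-rec _ step
  where
  step : ∀ (w : Permutation′ n) → (∀ v → μ v ℕ.< μ w → ∃[ C ] NestedChain v C) →
         ∃[ C ] NestedChain w C
  step w rec with firstUnsorted? w
  ... | inj₁ w≈w₀ = [] , noLinks w≈w₀
  ... | inj₂ (a , a!) with lexLast w a
  ...   | _ ∷ γ , last = _ ,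
    nestedLink (a! , γ , last) (proj₂ (rec _ (tight-μ w (nested⇒tight w (proj₁ last)))))
  -- The greedy pair is an increasing sequence of length two, so a longest one cannot be a single
  -- entry.
  ...   | [] , (_ , longest) , _ =
    contradiction (longest (a ∷ b ∷ []) (refl , (a<b , wa<wb) ∷ [-])) ℕ.1+n≰n
    where
    b = proj₁ (greedyPair w a!)
    open Tight (greedy⇒tight w (proj₂ (greedyPair w a!)))

-- Induction along greedy links: off `a` neither side changes, and at `a` the left side drops by at
-- most one while the right side drops by exactly one.
raj≤invcode‾ : (w : Permutation′ n) (k : Fin n) → rajcode‾ w k ℕ.≤ invcode‾ w k
raj≤invcode‾ {n} = μ-rec _ step
  where
  step : ∀ (w : Permutation′ n) → (∀ v → μ v ℕ.< μ w → ∀ k → rajcode‾ v k ℕ.≤ invcode‾ v k) →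
         ∀ k → rajcode‾ w k ℕ.≤ invcode‾ w k
  step w rec k with firstUnsorted? w
  ... | inj₁ w≈w₀ = ℕ.≤-trans (ℕ.≤-reflexive (raj-sorted w (λ j _ → w≈w₀ j) (w≈w₀ k))) z≤n
  ... | inj₂ (a , a!) with k ≟ a
  ...   | yes refl = ℕ.≤-trans raj-suc (subst (suc (rajcode‾ w′ k) ℕ.≤_) (sym invcode‾-at)
    (s≤s (rec w′ (tight-μ w (greedy⇒tight w g)) k)))
    where g = proj₂ (greedyPair w a!)
          open GreedyStep w g
  ...   | no k≢a   = subst₂ ℕ._≤_ (raj-off k k≢a) (invcode‾-off k k≢a)
    (rec w′ (tight-μ w (greedy⇒tight w g)) k)
    where g = proj₂ (greedyPair w a!)
          open GreedyStep w g

-- Mark counts of interpolating chains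

record Interpolates (w : Permutation′ n) (x : Fin n → ℕ) : Set where
  constructor interpolates
  field
    raj≤  : ∀ k → rajcode‾ w k ℕ.≤ x k
    ≤inv  : ∀ k → x k ℕ.≤ invcode‾ w k
    split : ∀ j k → j < k → x j ≡ invcode‾ w j ⊎ x k ≡ rajcode‾ w k

open Interpolates

raj-interpolates : (w : Permutation′ n) → Interpolates w (rajcode‾ w)
raj-interpolates w = interpolates (λ _ → ℕ.≤-refl) (raj≤invcode‾ w) (λ _ _ _ → inj₂ refl)

interpolates-cong : {x y : Fin n → ℕ} → x ≗ y → Interpolates w x → Interpolates w y
interpolates-cong x≗y i = interpolates
  (λ k → subst (_ ℕ.≤_) (x≗y k) (raj≤ i k))
  (λ k → subst (ℕ._≤ _) (x≗y k) (≤inv i k))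
  (λ j k j<k → [ inj₁ ∘ trans (sym (x≗y j)) , inj₂ ∘ trans (sym (x≗y k)) ]′ (split i j k j<k))

module _ (w : Permutation′ n) {a b : Fin n} (g : IsGreedyPair w (a , b)) {x y : Fin n → ℕ}
         (xa : x a ≡ suc (y a)) (x≗y : ∀ k → k ≢ a → x k ≡ y k) where
  open GreedyStep w g

  private
    prefix-zero : ∀ {j} → j < a → invcode‾ w j ≡ 0
    prefix-zero {j} j<a = invcode‾-sorted w (sorted-prefix w sorted j<a) (sorted j j<a)
      where sorted = proj₂ (proj₁ g)

    prefix≢ : ∀ {j} → j < a → j ≢ a
    prefix≢ j<a refl = Fin.<-irrefl refl j<a

    -- Matching on k ≟ a directly would also abstract the test hidden in w′.
    on-or-off : {P : Fin n → Set} → P a → (∀ k → k ≢ a → P k) → ∀ k → P k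
    on-or-off {P} on off k with k ≟ a
    ... | yes k≡a = subst P (sym k≡a) on
    ... | no k≢a  = off k k≢a

  greedy-interpolates : Interpolates w′ y → Interpolates w x
  greedy-interpolates i = interpolates raj≤x x≤inv split′
    where
    raj≤x : ∀ k → rajcode‾ w k ℕ.≤ x k
    raj≤x = on-or-off
      (subst (rajcode‾ w a ℕ.≤_) (sym xa) (ℕ.≤-trans raj-suc (s≤s (raj≤ i a))))
      (λ k k≢a → subst₂ ℕ._≤_ (raj-off k k≢a) (sym (x≗y k k≢a)) (raj≤ i k))
    x≤inv : ∀ k → x k ℕ.≤ invcode‾ w k
    x≤inv = on-or-off
      (subst₂ ℕ._≤_ (sym xa) (sym invcode‾-at) (s≤s (≤inv i a)))
      (λ k k≢a → subst₂ ℕ._≤_ (sym (x≗y k k≢a)) (invcode‾-off k k≢a) (≤inv i k))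
    full : ∀ j → y j ≡ invcode‾ w′ j → x j ≡ invcode‾ w j
    full = on-or-off
      (λ ya → trans xa (trans (cong suc ya) (sym invcode‾-at)))
      (λ j j≢a yj → trans (x≗y j j≢a) (trans yj (invcode‾-off j j≢a)))
    split′ : ∀ j k → j < k → x j ≡ invcode‾ w j ⊎ x k ≡ rajcode‾ w k
    split′ j = on-or-off
      -- At `k = a` the equality with `rajcode‾` may be lost, but before `a` the upper bound is 0
      -- and the first alternative holds.
      (λ j<a → inj₁ (trans (ℕ.n≤0⇒n≡0 (subst (x j ℕ.≤_) (prefix-zero j<a) (x≤inv j)))
        (sym (prefix-zero j<a))))
      (λ k k≢a j<k →
        [ inj₁ ∘ full j , (λ yk → inj₂ (trans (x≗y k k≢a) (trans yk (raj-off k k≢a)))) ]′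
        (split i j k j<k))

  -- The two cases of `room` are those in which lowering `x a` respects the new lower bound: either
  -- `x a` was strictly above the old bound, or `y a` equals `invcode‾ w′ a`.
  greedy-interpolates⁻ : rajcode‾ w a ℕ.< x a ⊎ x a ≡ invcode‾ w a →
                         Interpolates w x → Interpolates w′ y
  greedy-interpolates⁻ room i = interpolates raj≤y y≤inv split′
    where
    full : ∀ j → x j ≡ invcode‾ w j → y j ≡ invcode‾ w′ j
    full = on-or-off
      (λ eq → ℕ.suc-injective (trans (sym xa) (trans eq invcode‾-at)))
      (λ j j≢a xj → trans (sym (x≗y j j≢a)) (trans xj (sym (invcode‾-off j j≢a))))
    raj≤y : ∀ k → rajcode‾ w′ k ℕ.≤ y k
    raj≤y = on-or-off
      ([ (λ raj<x → ℕ.≤-trans raj-le (ℕ.s≤s⁻¹ (subst (rajcode‾ w a ℕ.<_) xa raj<x)))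
       , (λ xa≡ → subst (rajcode‾ w′ a ℕ.≤_) (sym (full a xa≡)) (raj≤invcode‾ w′ a)) ]′ room)
      (λ k k≢a → subst₂ ℕ._≤_ (sym (raj-off k k≢a)) (x≗y k k≢a) (raj≤ i k))
    y≤inv : ∀ k → y k ℕ.≤ invcode‾ w′ k
    y≤inv = on-or-off
      (ℕ.s≤s⁻¹ (subst₂ ℕ._≤_ xa invcode‾-at (≤inv i a)))
      (λ k k≢a → subst₂ ℕ._≤_ (x≗y k k≢a) (sym (invcode‾-off k k≢a)) (≤inv i k))
    split′ : ∀ j k → j < k → y j ≡ invcode‾ w′ j ⊎ y k ≡ rajcode‾ w′ k
    split′ j = on-or-off
      (λ j<a → let inv′j = trans (invcode‾-off j (prefix≢ j<a)) (prefix-zero j<a) in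
        inj₁ (trans (ℕ.n≤0⇒n≡0 (subst (y j ℕ.≤_) inv′j (y≤inv j))) (sym inv′j)))
      (λ k k≢a j<k →
        [ inj₁ ∘ full j
        , (λ xk → inj₂ (trans (sym (x≗y k k≢a)) (trans xk (sym (raj-off k k≢a))))) ]′
        (split i j k j<k))

marks-greedy : ∀ (c : Link n) C {p} → p ℕ.≤ length C → ∀ k →
               marks (c ∷ C) (U p (c ∷ C)) k ≡ ind (proj₁ c ≟ k) + marks C (U p C) k
marks-greedy c C {p} p≤ k =
  trans (cong (λ S → marks (c ∷ C) S k) (U-∷ c C p≤)) (marks-∷ c C true (U p C) k)

marks-interpolates : (w : Permutation′ n) → Interpolating w p C → Interpolates w (marks C (U p C))
marks-interpolates {C = C} w (nestedTail i) = interpolates-cong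
  (λ k → sym (trans (cong (λ S → marks C S k) (U-length C)) (marks-nested w i k)))
  (raj-interpolates w)
marks-interpolates {p = p} {C = c ∷ C} w (greedyLink g i) = greedy-interpolates w g
  (trans (marks-greedy c C (p≤length i) (proj₁ c))
    (cong (_+ marks C (U p C) _) (ind-yes (proj₁ c ≟ proj₁ c) refl)))
  (λ k k≢a → trans (marks-greedy c C (p≤length i) k)
    (cong (_+ marks C (U p C) _) (ind-no (proj₁ c ≟ k) (k≢a ∘ sym))))
  (marks-interpolates (w · c) i)

-- As long as `x` differs from `rajcode‾ w`, the chain continues with the greedy link and `x` is
-- lowered at its first position. Once they agree a nested chain finishes it, and `p` is the length
-- of that tail.
interpolates⇒chain : (w : Permutation′ n) (x : Fin n → ℕ) → Interpolates w x →
                     ∃[ p ] ∃[ C ] Interpolating w p C × x ≗ marks C (U p C)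
interpolates⇒chain {n} = μ-rec _ step
  where
  Goal : Permutation′ n → Set
  Goal w = (x : Fin n → ℕ) → Interpolates w x →
           ∃[ p ] ∃[ C ] Interpolating w p C × x ≗ marks C (U p C)
  step : ∀ (w : Permutation′ n) → (∀ v → μ v ℕ.< μ w → Goal v) → Goal w
  step w rec x i with Fin.all? (λ k → x k ℕ.≟ rajcode‾ w k)
  ... | yes x≗raj = let C , chain = nestedChain w in
    length C , C , nestedTail chain ,
    λ k → trans (x≗raj k)
      (sym (trans (cong (λ S → marks C S k) (U-length C)) (marks-nested w chain k)))
  ... | no x≢raj with least (λ k → x k ℕ.≟ rajcode‾ w k) x≢raj
  ...   | k , xk≢ , _ = go (firstUnsorted? w)
    where
    sorted⊥ : SortedBefore w k → ¬ w ⟨$⟩ʳ k ≡ w₀ ⟨$⟩ʳ k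
    sorted⊥ sorted wk = xk≢ (trans
      (ℕ.n≤0⇒n≡0 (subst (x k ℕ.≤_) (invcode‾-sorted w sorted wk) (≤inv i k)))
      (sym (raj-sorted w sorted wk)))
    go : w ≈ w₀ ⊎ ∃[ a ] FirstUnsorted w a → ∃[ p ] ∃[ C ] Interpolating w p C × x ≗ marks C (U p C)
    go (inj₁ w≈w₀) = contradiction (w≈w₀ k) (sorted⊥ λ j _ → w≈w₀ j)
    go (inj₂ (a , a!)) =
      let p , C , chain , y≗ = rec (w · (a , b)) (tight-μ w (greedy⇒tight w g)) y
                                 (greedy-interpolates⁻ w g xa x≗y room i)
      in p , (a , b) ∷ C , greedyLink g chain , λ j → sym
           (trans (marks-greedy (a , b) C (p≤length chain) j) (total (sym ∘ y≗) j))
      where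
      b = proj₁ (greedyPair w a!)
      g = proj₂ (greedyPair w a!)
      open GreedyStep w g using (invcode‾-at)
      -- The position `k` where `x` exceeds `rajcode‾` cannot lie before `a`, where both codes
      -- vanish. If it is `a`, there is slack; if it lies after `a`, then `split` makes `x a`
      -- maximal.
      room : rajcode‾ w a ℕ.< x a ⊎ x a ≡ invcode‾ w a
      room with Fin.<-cmp k a
      ... | tri< k<a _ _ = contradiction (proj₂ a! k k<a) (sorted⊥ (sorted-prefix w (proj₂ a!) k<a))
      ... | tri≈ _ refl _ = inj₁ (ℕ.≤∧≢⇒< (raj≤ i k) (xk≢ ∘ sym))
      ... | tri> _ _ a<k = inj₂ ([ id , (λ xk → contradiction xk xk≢) ]′ (split i a k a<k))
      y : Fin n → ℕ
      y = updateAt x a pred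
      xa : x a ≡ suc (y a)
      xa = trans (sym (ℕ.suc-pred (x a) ⦃ ℕ.>-nonZero 0<xa ⦄)) (cong suc (sym (updateAt-updates a x)))
        where
        0<xa : 0 ℕ.< x a
        0<xa = [ ℕ.≤-<-trans z≤n
               , (λ xa≡ → subst (0 ℕ.<_) (sym (trans xa≡ invcode‾-at)) (s≤s z≤n)) ]′ room
      x≗y : ∀ k → k ≢ a → x k ≡ y k
      x≗y k k≢a = sym (updateAt-minimal k a x k≢a)
      total : ∀ {z : Fin n → ℕ} → z ≗ y → ∀ j → ind (a ≟ j) + z j ≡ x j
      total z≗y j with a ≟ j
      ... | yes refl = trans (cong suc (z≗y j)) (sym xa)
      ... | no a≢j   = trans (z≗y j) (sym (x≗y j (a≢j ∘ sym)))

-- Codes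

-- By definition `rajcode w` is `code` of `rajcode‾ w`, and `wt C S` is `code` of `marks C S`; only
-- for `invcode` does the analogous identity need an argument.
code : (Fin n → ℕ) → Fin n → ℤ
code {n} x k = + n ℤ.- + suc (toℕ k) ℤ.- + x k

code-suc : (x y : Fin n → ℕ) (k : Fin n) → x k ≡ suc (y k) → code x k ℤ.+ + 1 ≡ code y k
code-suc {n} x y k xk rewrite xk = solve 3
  (λ n s y → n :- s :- (con (+ 1) :+ y) :+ con (+ 1) := n :- s :- y) refl (+ n) (+ suc (toℕ k)) (+ y k)
  where open ℤ.+-*-Solver

code-mono : (x y : Fin n → ℕ) (k : Fin n) → x k ℕ.≤ y k → code y k ℤ.≤ code x k
code-mono {n} x y k x≤y = ℤ.+-monoʳ-≤ (+ n ℤ.- + suc (toℕ k)) (ℤ.neg-mono-≤ (ℤ.+≤+ x≤y))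

code-mono-< : (x y : Fin n → ℕ) (k : Fin n) → x k ℕ.< y k → code y k ℤ.< code x k
code-mono-< {n} x y k x<y = ℤ.+-monoʳ-< (+ n ℤ.- + suc (toℕ k)) (ℤ.neg-mono-< (ℤ.+<+ x<y))

code-cancel-< : (x y : Fin n → ℕ) (k : Fin n) → code y k ℤ.< code x k → x k ℕ.< y k
code-cancel-< x y k lt = ℕ.≰⇒> λ y≤x → ℤ.<⇒≱ lt (code-mono y x k y≤x)

Σ-≤ : (k : Fin n) → Σ {n} (λ j → ind (j ≤? k)) ≡ suc (toℕ k)
Σ-≤ {suc n} zero    = cong suc (trans
  (sum-cong-≗ {n} λ j → ind-no (suc j ≤? zero {n}) λ ()) (sum-replicate-zero n))
Σ-≤ {suc n} (suc k) = cong suc (trans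
  (sum-cong-≗ {n} λ j → ind-cong (suc j ≤? suc k) (j ≤? k) ℕ.s≤s⁻¹ s≤s) (Σ-≤ k))

Σ-1 : ∀ n → Σ {n} (const 1) ≡ n
Σ-1 zero    = refl
Σ-1 (suc n) = cong suc (Σ-1 n)

-- The `n` positions split into those up to `k` and the later ones with smaller or larger value, so
-- the three counts add up to `n`.
invcode≗code : (w : Permutation′ n) → invcode w ≗ code (invcode‾ w)
invcode≗code {n} w k = begin
  + I                                  ≡⟨ solve 3 (λ i j s → i := i :+ j :+ s :- s :- j) refl
                                            (+ I) (+ J) (+ s) ⟩
  + I ℤ.+ + J ℤ.+ + s ℤ.- + s ℤ.- + J  ≡⟨ cong (λ m → + m ℤ.- + s ℤ.- + J) total ⟩
  + n ℤ.- + s ℤ.- + J                  ∎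
  where
  open ≡-Reasoning
  open ℤ.+-*-Solver
  I = #[ (λ j → (k <? j) ×-dec ((w ⟨$⟩ʳ j) <? (w ⟨$⟩ʳ k))) ]
  J = invcode‾ w k
  s = suc (toℕ k)
  f g h : Fin n → ℕ
  f j = ind ((k <? j) ×-dec ((w ⟨$⟩ʳ j) <? (w ⟨$⟩ʳ k)))
  g j = ind ((k <? j) ×-dec ((w ⟨$⟩ʳ k) <? (w ⟨$⟩ʳ j)))
  h j = ind (j ≤? k)
  sum₃ : ∀ {x y z x′ y′ z′} → x ≡ x′ → y ≡ y′ → z ≡ z′ → x + y + z ≡ x′ + y′ + z′
  sum₃ refl refl refl = refl
  one : ∀ j → f j + g j + h j ≡ 1
  one j with j ≤? k
  ... | yes j≤k = sum₃
    (ind-no ((k <? j) ×-dec ((w ⟨$⟩ʳ j) <? (w ⟨$⟩ʳ k))) λ (k<j , _) → ℕ.<⇒≱ k<j j≤k)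
    (ind-no ((k <? j) ×-dec ((w ⟨$⟩ʳ k) <? (w ⟨$⟩ʳ j))) λ (k<j , _) → ℕ.<⇒≱ k<j j≤k)
    (ind-yes (j ≤? k) j≤k)
  ... | no j≰k with Fin.<-cmp (w ⟨$⟩ʳ j) (w ⟨$⟩ʳ k)
  ...   | tri< wj<wk _ _ = sum₃
    (ind-yes ((k <? j) ×-dec ((w ⟨$⟩ʳ j) <? (w ⟨$⟩ʳ k))) (ℕ.≰⇒> j≰k , wj<wk))
    (ind-no ((k <? j) ×-dec ((w ⟨$⟩ʳ k) <? (w ⟨$⟩ʳ j))) λ (_ , wk<wj) → Fin.<-asym wj<wk wk<wj)
    (ind-no (j ≤? k) j≰k)
  ...   | tri> _ _ wk<wj = sum₃
    (ind-no ((k <? j) ×-dec ((w ⟨$⟩ʳ j) <? (w ⟨$⟩ʳ k))) λ (_ , wj<wk) → Fin.<-asym wj<wk wk<wj)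
    (ind-yes ((k <? j) ×-dec ((w ⟨$⟩ʳ k) <? (w ⟨$⟩ʳ j))) (ℕ.≰⇒> j≰k , wk<wj))
    (ind-no (j ≤? k) j≰k)
  ...   | tri≈ _ wj≡wk _ = contradiction (ℕ.≤-reflexive (cong toℕ (injective w wj≡wk))) j≰k
  total : I + J + s ≡ n
  total = begin
    I + J + s                    ≡⟨ sum₃ (count≡Σ (λ j → (k <? j) ×-dec ((w ⟨$⟩ʳ j) <? (w ⟨$⟩ʳ k))))
                                         (invcode‾-Σ w k) (sym (Σ-≤ k)) ⟩
    Σ f + Σ g + Σ h              ≡⟨ cong (_+ Σ h) (∑-distrib-+ f g) ⟨
    Σ (λ j → f j + g j) + Σ h    ≡⟨ ∑-distrib-+ (λ j → f j + g j) h ⟨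
    Σ (λ j → f j + g j + h j)    ≡⟨ sum-cong-≗ one ⟩
    Σ {n} (const 1)              ≡⟨ Σ-1 n ⟩
    n                            ∎

sum-gap : (f g : Fin n → ℤ) (d : Fin n → ℕ) → (∀ k → f k ℤ.+ + d k ℤ.≤ g k) →
          Σℤ f ℤ.+ + Σ d ℤ.≤ Σℤ g
sum-gap {zero}  f g d gap = ℤ.≤-refl
sum-gap {suc n} f g d gap = ℤ.≤-trans
  (ℤ.≤-reflexive (solve 4 (λ a b c d → a :+ b :+ (c :+ d) := a :+ c :+ (b :+ d)) refl
    (f zero) (Σℤ (f ∘ suc)) (+ d zero) (+ Σ (d ∘ suc))))
  (ℤ.+-mono-≤ (gap zero) (sum-gap (f ∘ suc) (g ∘ suc) (d ∘ suc) (gap ∘ suc)))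
  where open ℤ.+-*-Solver

-- Leads

last-∷ : ∀ {A : Set} (x : A) xs → last (x ∷ xs) ≡ just (fromMaybe x (last xs))
last-∷ x []       = refl
last-∷ x (y ∷ ys) rewrite last-∷ y ys = refl

-- Specifies the search inside `L`; the case `nothing` is the one in which `L` has become constant.
IsLargest : Pred (Fin n) 0ℓ → List (Fin n) → Maybe (Fin n) → Set
IsLargest P xs nothing  = All (¬_ ∘ P) xs
IsLargest P xs (just j) = j ∈ xs × P j × All (λ k → j < k → ¬ P k) xs

last-largest : {P : Pred (Fin n) 0ℓ} (P? : Decidable P) {xs : List (Fin n)} → AllPairs _<_ xs →
               IsLargest P xs (last (filter P? xs))
last-largest P? [] = []
last-largest P? {x ∷ xs} (x< ∷ xs↗) with P? x | last-largest P? xs↗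
... | no ¬Px | ih with last (filter P? xs)
...   | nothing = ¬Px ∷ ih
...   | just j  = let j∈ , Pj , above = ih in there j∈ , Pj , (λ _ → ¬Px) ∷ above
last-largest P? {x ∷ xs} (x< ∷ xs↗) | yes Px | ih rewrite last-∷ x (filter P? xs) with last (filter P? xs)
...   | nothing = here refl , Px , (λ x<x → contradiction x<x (Fin.<-irrefl refl)) ∷ All.map const ih
...   | just j  = let j∈ , Pj , above = ih
                  in there j∈ , Pj , (λ j<x → contradiction j<x (Fin.<-asym (All.lookup x< j∈))) ∷ above

open Interpolates

module _ (w : Permutation′ n) where

  private
    R I : Fin n → ℕ
    R = rajcode‾ w
    I = invcode‾ w

    below? : ∀ i → Decidable (λ j → L w i j ℤ.< rajcode w j)
    below? i j = L w i j ℤ.<? rajcode w j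

    e-self : ∀ (j : Fin n) → e j j ≡ + 1
    e-self j with j ≟ j
    ... | yes _  = refl
    ... | no j≢j = contradiction refl j≢j

    e-other : ∀ {j k : Fin n} → k ≢ j → e j k ≡ + 0
    e-other {j} {k} k≢j with j ≟ k
    ... | yes j≡k = contradiction (sym j≡k) k≢j
    ... | no _    = refl

    increment : (x y : Fin n → ℕ) (j : Fin n) → x j ≡ suc (y j) → (∀ k → k ≢ j → x k ≡ y k) →
                ∀ k → code x k ℤ.+ e j k ≡ code y k
    increment x y j xj x≗y k with k ≟ j
    ... | yes refl = trans (cong (λ z → code x k ℤ.+ z) (e-self k)) (code-suc x y k xj)
    ... | no k≢j   = trans (cong (λ z → code x k ℤ.+ z) (e-other k≢j))
      (trans (ℤ.+-identityʳ _) (cong (λ z → + n ℤ.- + suc (toℕ k) ℤ.- + z) (x≗y k k≢j)))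

  largest-below : ∀ i →
    IsLargest (λ j → L w i j ℤ.< rajcode w j) (allFin n) (last (filter (below? i) (allFin n)))
  largest-below i = last-largest (below? i) (tabulate⁺-< id)

  -- Adding `e j` to a lead lowers `x j` by one. The choice of the largest eligible `j` means that
  -- `x` already equals `rajcode‾` beyond `j`, which preserves `split`. Since `L` eventually stays
  -- constant, every `i` is covered.
  lead-interpolates : ∀ i → ∃[ x ] Interpolates w x × L w i ≗ code x
  lead-interpolates zero = I ,
    interpolates (raj≤invcode‾ w) (λ _ → ℕ.≤-refl) (λ _ _ _ → inj₁ refl) , invcode≗code w
  lead-interpolates (suc i)
    with lead-interpolates i | last (filter (below? i) (allFin n)) | largest-below i
  ... | ih         | nothing | _ = ih
  ... | x , ix , L≗ | just j | _ , Lj< , above = y , interpolates R≤y y≤I split′ ,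
      λ k → trans (cong (ℤ._+ e j k) (L≗ k)) (increment x y j xj x≗y k)
    where
    y : Fin n → ℕ
    y = updateAt x j pred
    R<xj : R j ℕ.< x j
    R<xj = code-cancel-< R x j (subst (ℤ._< rajcode w j) (L≗ j) Lj<)
    xj : x j ≡ suc (y j)
    xj = trans (sym (ℕ.suc-pred (x j) ⦃ ℕ.>-nonZero (ℕ.≤-<-trans z≤n R<xj) ⦄))
      (cong suc (sym (updateAt-updates j x)))
    x≗y : ∀ k → k ≢ j → x k ≡ y k
    x≗y k k≢j = sym (updateAt-minimal k j x k≢j)
    R≤y : ∀ k → R k ℕ.≤ y k
    R≤y k with k ≟ j
    ... | yes refl = ℕ.s≤s⁻¹ (subst (R k ℕ.<_) xj R<xj)
    ... | no k≢j   = subst (R k ℕ.≤_) (x≗y k k≢j) (raj≤ ix k)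
    y≤I : ∀ k → y k ℕ.≤ I k
    y≤I k with k ≟ j
    ... | yes refl = ℕ.≤-trans (ℕ.n≤1+n _) (subst (ℕ._≤ I k) xj (≤inv ix k))
    ... | no k≢j   = subst (ℕ._≤ I k) (x≗y k k≢j) (≤inv ix k)
    split′ : ∀ l k → l < k → y l ≡ I l ⊎ y k ≡ R k
    split′ l k l<k with k ≟ j
    ... | yes refl = [ (λ xl → inj₁ (trans (sym (x≗y l λ { refl → Fin.<-irrefl refl l<k })) xl))
                     , (λ xk → contradiction (sym xk) (ℕ.<⇒≢ R<xj)) ]′ (split ix l k l<k)
    ... | no k≢j with l ≟ j
    ...   | no l≢j   = [ inj₁ ∘ trans (sym (x≗y l l≢j)) , inj₂ ∘ trans (sym (x≗y k k≢j)) ]′ (split ix l k l<k)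
    ...   | yes refl = inj₂ (trans (sym (x≗y k k≢j)) (ℕ.≤-antisym
      (ℕ.≮⇒≥ λ R<x → All.lookup above (∈-allFin k) l<k
        (subst (ℤ._< rajcode w k) (sym (L≗ k)) (code-mono-< R x k R<x)))
      (raj≤ ix k)))

  -- The index of a lead is its total deficit from `invcode‾`. The last step is undone at the first
  -- position `k` with a deficit, giving `y`. Beyond `k`, `split` forces `rajcode‾`, so `k` is the
  -- largest position where `y` exceeds `rajcode‾`, the one that `L` selects.
  interpolates⇒lead : ∀ i x → Interpolates w x → Σ (λ k → I k ∸ x k) ≡ i → code x ≗ L w i
  interpolates⇒lead zero x ix Σ≡0 k = trans
    (cong (λ z → + n ℤ.- + suc (toℕ k) ℤ.- + z) (ℕ.≤-antisym (≤inv ix k)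
      (ℕ.m∸n≡0⇒m≤n (ℕ.n≤0⇒n≡0 (subst (I k ∸ x k ℕ.≤_) Σ≡0 (fk≤Σf (λ k → I k ∸ x k) k))))))
    (sym (invcode≗code w k))
  interpolates⇒lead (suc i) x ix Σ≡ with least (λ k → x k ℕ.≟ I k)
    (λ x≗I → case trans (sym Σ≡) (trans
      (sum-cong-≗ λ k → ℕ.m≤n⇒m∸n≡0 (ℕ.≤-reflexive (sym (x≗I k)))) (sum-replicate-zero n)) of λ ())
  ... | k , xk≢ , xbelow = λ l → trans (sym (increment y x k yk y≗x l))
    (matches (last (filter (below? i) (allFin n))) (largest-below i) l)
    where
    y : Fin n → ℕ
    y = updateAt x k suc
    yk : y k ≡ suc (x k)
    yk = updateAt-updates k x
    y≗x : ∀ l → l ≢ k → y l ≡ x l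
    y≗x l l≢k = updateAt-minimal l k x l≢k
    xk<I : x k ℕ.< I k
    xk<I = ℕ.≤∧≢⇒< (≤inv ix k) xk≢
    R<yk : R k ℕ.< y k
    R<yk = subst (R k ℕ.<_) (sym yk) (s≤s (raj≤ ix k))
    R≤y : ∀ l → R l ℕ.≤ y l
    R≤y l with l ≟ k
    ... | yes refl = ℕ.<⇒≤ R<yk
    ... | no l≢k   = subst (R l ℕ.≤_) (sym (y≗x l l≢k)) (raj≤ ix l)
    y≤I : ∀ l → y l ℕ.≤ I l
    y≤I l with l ≟ k
    ... | yes refl = subst (ℕ._≤ I l) (sym yk) xk<I
    ... | no l≢k   = subst (ℕ._≤ I l) (sym (y≗x l l≢k)) (≤inv ix l)
    after : ∀ l → k < l → x l ≡ R l
    after l k<l = [ (λ xk → contradiction xk xk≢) , id ]′ (split ix k l k<l)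
    split′ : ∀ j l → j < l → y j ≡ I j ⊎ y l ≡ R l
    split′ j l j<l with Fin.<-cmp k l
    ... | tri< k<l k≢l _  = inj₂ (trans (y≗x l (k≢l ∘ sym)) (after l k<l))
    ... | tri≈ _ refl _   = inj₁ (trans (y≗x j (Fin.<⇒≢ j<l)) (xbelow j j<l))
    ... | tri> _ _ l<k    = inj₁ (trans (y≗x j (Fin.<⇒≢ j<k)) (xbelow j j<k))
      where j<k = Fin.<-trans j<l l<k
    Σ≡i : Σ (λ l → I l ∸ y l) ≡ i
    Σ≡i = ℕ.+-cancelʳ-≡ (suc (I k ∸ y k)) _ _ (begin
      Σ (λ l → I l ∸ y l) + suc (I k ∸ y k)  ≡⟨ cong (Σ (λ l → I l ∸ y l) ℕ.+_) Ik∸xk ⟨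
      Σ (λ l → I l ∸ y l) + (I k ∸ x k)      ≡⟨ Σ-update k (λ l l≢k → cong (I l ∸_) (sym (y≗x l l≢k))) ⟩
      Σ (λ l → I l ∸ x l) + (I k ∸ y k)      ≡⟨ cong (_+ (I k ∸ y k)) Σ≡ ⟩
      suc i + (I k ∸ y k)                    ≡⟨ ℕ.+-suc i _ ⟨
      i + suc (I k ∸ y k)                    ∎)
      where
      open ≡-Reasoning
      Ik∸xk : I k ∸ x k ≡ suc (I k ∸ y k)
      Ik∸xk = trans (ℕ.+-∸-assoc 1 xk<I) (cong (λ z → suc (I k ∸ z)) (sym yk))
    ih : code y ≗ L w i
    ih = interpolates⇒lead i y (interpolates R≤y y≤I split′) Σ≡i
    Lk< : L w i k ℤ.< rajcode w k
    Lk< = subst (ℤ._< rajcode w k) (ih k) (code-mono-< R y k R<yk)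
    matches : ∀ j? → IsLargest (λ j → L w i j ℤ.< rajcode w j) (allFin n) j? →
           ∀ l → code y l ℤ.+ e k l ≡ maybe′ (λ j k → L w i k ℤ.+ e j k) (L w i) j? l
    matches nothing  none = contradiction Lk< (All.lookup none (∈-allFin k))
    -- An index before `k` would not be the largest, and beyond `k` the entries of `y` are already
    -- minimal.
    matches (just j) (_ , Lj< , above) l with Fin.<-cmp j k
    ... | tri< j<k _ _  = contradiction Lk< (All.lookup above (∈-allFin k) j<k)
    ... | tri≈ _ refl _ = cong (ℤ._+ e k l) (ih l)
    ... | tri> _ j≢k k<j = contradiction (sym (trans (y≗x j j≢k) (after j k<j)))
      (ℕ.<⇒≢ (code-cancel-< R y j (subst (ℤ._< rajcode w j) (sym (ih j)) Lj<)))

  -- Pointwise, `invcode w` plus the deficit is `code x`, which is at most `rajcode w`; the bound is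
  -- the sum of these inequalities.
  interpolates⇒bound : ∀ x → Interpolates w x → + Σ (λ k → I k ∸ x k) ℤ.≤ raj w ℤ.- inv w
  interpolates⇒bound x ix = ℤ.≤-trans
    (ℤ.≤-reflexive (solve 2 (λ d v → d := v :+ d :- v) refl (+ Σ d) (inv w)))
    (ℤ.+-monoˡ-≤ (ℤ.- inv w) (sum-gap (invcode w) (rajcode w) d gap))
    where
    open ℤ.+-*-Solver
    d : Fin n → ℕ
    d k = I k ∸ x k
    gap : ∀ k → invcode w k ℤ.+ + d k ℤ.≤ rajcode w k
    gap k = ℤ.≤-trans (ℤ.≤-reflexive eq) (code-mono R x k (raj≤ ix k))
      where
      eq : invcode w k ℤ.+ + d k ≡ code x k
      eq = begin
        invcode w k ℤ.+ + d k
          ≡⟨ cong (ℤ._+ + d k) (invcode≗code w k) ⟩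
        + n ℤ.- + suc (toℕ k) ℤ.- + I k ℤ.+ + d k
          ≡⟨ cong (λ z → + n ℤ.- + suc (toℕ k) ℤ.- + z ℤ.+ + d k) (ℕ.m+[n∸m]≡n (≤inv ix k)) ⟨
        + n ℤ.- + suc (toℕ k) ℤ.- (+ x k ℤ.+ + d k) ℤ.+ + d k
          ≡⟨ solve 3 (λ a x d → a :- (x :+ d) :+ d := a :- x) refl
               (+ n ℤ.- + suc (toℕ k)) (+ x k) (+ d k) ⟩
        code x k ∎
        where open ≡-Reasoning

theorem9p9 : ∀ (n : ℕ) (w : Permutation′ n) (m : ℕ) →
    (∀ C → IsClimbingChain w C → length C ≡ m) →
    (λ v → ∃[ i ] + i ℤ.≤ raj w ℤ.- inv w × v ≗ L w i)
    ≐
    (λ v → ∃[ p ] p ℕ.≤ m × ∃[ C ] IsInterpolatingChain w p C × v ≗ wt C (U p C))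
theorem9p9 n w m length≡m = lead⇒weight , weight⇒lead
  where
  lead⇒weight : {v : Fin n → ℤ} → ∃[ i ] + i ℤ.≤ raj w ℤ.- inv w × v ≗ L w i →
                ∃[ p ] p ℕ.≤ m × ∃[ C ] IsInterpolatingChain w p C × v ≗ wt C (U p C)
  lead⇒weight (i , _ , v≗) =
    let x , ix , L≗ = lead-interpolates w i
        p , C , chain , x≗ = interpolates⇒chain w x ix
        isChain = toChain chain
    in p , subst (p ℕ.≤_) (length≡m C (IsInterpolatingChain.isClimbingChain isChain)) (p≤length chain) ,
       C , isChain , λ k → trans (v≗ k) (trans (L≗ k) (cong (λ y → + n ℤ.- + suc (toℕ k) ℤ.- + y) (x≗ k)))

  weight⇒lead : {v : Fin n → ℤ} →
                ∃[ p ] p ℕ.≤ m × ∃[ C ] IsInterpolatingChain w p C × v ≗ wt C (U p C) →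
                ∃[ i ] + i ℤ.≤ raj w ℤ.- inv w × v ≗ L w i
  weight⇒lead (p , _ , C , isChain , v≗) =
    let x = marks C (U p C)
        ix = marks-interpolates w (fromChain isChain)
    -- The index of the lead is the total deficit of the mark counts from `invcode‾`.
    in Σ (λ k → invcode‾ w k ∸ x k) , interpolates⇒bound w x ix ,
       λ k → trans (v≗ k) (interpolates⇒lead w _ x ix refl k)
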